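{- Let $\ell \ge 2$ be an integer, let $n \in \mathbb{N}$, and let $q \in \mathbb{R}^+$ be defined by $n = 2(q^\ell + q^{\ell-1} + \dots + 1)$. Then $\mathrm{z}(n, \mathcal{C}_{2\ell}) \le \frac12 (q+1) n$.
   Context: Graphs are finite and simple. $C_j$ denotes the cycle of length $j$, and $\mathcal{C}_{2\ell} = \{C_4, C_6, \dots, C_{2\ell}\}$. A graph is $\mathcal{F}$-free if it contains no member of the family $\mathcal{F}$ as a (not necessarily induced) subgraph. $\mathrm{z}(n,\mathcal{F})$ is the maximum number of edges in an $\mathcal{F}$-free bipartite graph on $n$ vertices. $\mathbb{R}^+$ is the set of positive reals. -}

module Defs where

open import Data.Bool using (Bool; true; false; T; _∨_)
open import Data.Bool.Properties using (∨-comm; T?) renaming (_≟_ to _≟ᵇ_)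
open import Data.Empty using (⊥-elim)
open import Data.Fin using (Fin; zero; suc; toℕ) renaming (_<_ to _<ᶠ_; _<?_ to _<ᶠ?_)
open import Data.Fin.Properties using (any?; all?; toℕ<n) renaming (_≟_ to _≟ᶠ_)
open import Data.Integer using (+_)
open import Data.List using (List; []; _∷_; length; filter; cartesianProduct; allFin; map; upTo)
open import Data.List.Properties using (length-filter; filter-≐)
open import Data.List.Relation.Unary.All as All using (All)
open import Data.List.Relation.Unary.All.Properties using (map⁺)
open import Data.Nat as ℕ using (ℕ; zero; suc; z≤n; s≤s; _∸_; _⊔_; _≡ᵇ_; _%_)
import Data.Nat.Properties as ℕₚ
open import Data.Nat.DivMod using (m<n⇒m%n≡m; n%n≡0)
open import Data.Product using (Σ; ∃; _×_; _,_; proj₁; proj₂)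
open import Data.Rational as ℚ using (ℚ; 0ℚ; 1ℚ; ½; ∣_∣; 1/_)
import Data.Rational.Properties as ℚₚ
open import Data.Rational.Solver using (module +-*-Solver)
open import Data.Sum using (inj₁; inj₂)
open import Data.Unit using (tt)
open import Data.Vec as Vec using (Vec)
open import Data.Vec.Properties using (lookup∘tabulate)
open import Function.Definitions using (Injective)
open import Relation.Binary.PropositionalEquality
  using (_≡_; _≢_; _≗_; refl; sym; trans; cong; cong₂; subst; subst₂)
open import Relation.Nullary using (¬_; Dec; yes; no; ¬?)
open import Relation.Nullary.Decidable using (map′; _×-dec_; _→-dec_)
open import Relation.Unary using (Decidable)

-- Real numbers, as Cauchy sequences of rationals with a modulus of
-- convergence, considered up to _≃_.

IsCauchy : (ℕ → ℚ) → Set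
IsCauchy x = ∀ ε → 0ℚ ℚ.< ε →
  ∃ λ N → ∀ m n → N ℕ.≤ m → N ℕ.≤ n → ∣ x m ℚ.- x n ∣ ℚ.≤ ε

record ℝ : Set where
  constructor mkℝ
  field
    seq    : ℕ → ℚ
    cauchy : IsCauchy seq

open ℝ public

infix 4 _≃_ _<_ _≤_

_≃_ : ℝ → ℝ → Set
x ≃ y = ∀ ε → 0ℚ ℚ.< ε →
  ∃ λ N → ∀ n → N ℕ.≤ n → ∣ seq x n ℚ.- seq y n ∣ ℚ.≤ ε

_<_ : ℝ → ℝ → Set
x < y = ∃ λ ε → 0ℚ ℚ.< ε ×
  ∃ λ N → ∀ n → N ℕ.≤ n → seq x n ℚ.+ ε ℚ.≤ seq y n

_≤_ : ℝ → ℝ → Set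
x ≤ y = ∀ ε → 0ℚ ℚ.< ε →
  ∃ λ N → ∀ n → N ℕ.≤ n → seq x n ℚ.≤ seq y n ℚ.+ ε

private
  half-pos : ∀ ε → 0ℚ ℚ.< ε → 0ℚ ℚ.< ½ ℚ.* ε
  half-pos ε ε>0 = subst (ℚ._< ½ ℚ.* ε) (ℚₚ.*-zeroʳ ½) (ℚₚ.*-monoʳ-<-pos ½ ε>0)

  halves : ∀ ε → ½ ℚ.* ε ℚ.+ ½ ℚ.* ε ≡ ε
  halves ε = trans (sym (ℚₚ.*-distribʳ-+ ε ½ ½)) (ℚₚ.*-identityˡ ε)

  rearrange-+ : ∀ a b c d → (a ℚ.+ b) ℚ.- (c ℚ.+ d) ≡ (a ℚ.- c) ℚ.+ (b ℚ.- d)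
  rearrange-+ = solve 4 (λ a b c d → (a :+ b) :- (c :+ d) := (a :- c) :+ (b :- d)) refl
    where open +-*-Solver

  rearrange-* : ∀ a b c d → a ℚ.* b ℚ.- c ℚ.* d ≡ a ℚ.* (b ℚ.- d) ℚ.+ d ℚ.* (a ℚ.- c)
  rearrange-* = solve 4 (λ a b c d → a :* b :- c :* d := a :* (b :- d) :+ d :* (a :- c)) refl
    where open +-*-Solver

  split : ∀ a b → a ≡ (a ℚ.- b) ℚ.+ b
  split = solve 2 (λ a b → a := (a :- b) :+ b) refl
    where open +-*-Solver

  ∣∣-nonneg : ∀ p → 0ℚ ℚ.≤ ∣ p ∣
  ∣∣-nonneg p = ℚₚ.nonNegative⁻¹ ∣ p ∣ {{ℚₚ.∣-∣-nonNeg p}}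

  *-mono-≤ : ∀ {a b c d} → 0ℚ ℚ.≤ b → 0ℚ ℚ.≤ c → a ℚ.≤ b → c ℚ.≤ d → a ℚ.* c ℚ.≤ b ℚ.* d
  *-mono-≤ {b = b} {c = c} 0≤b 0≤c a≤b c≤d = ℚₚ.≤-trans
    (ℚₚ.*-monoʳ-≤-nonNeg c {{ℚ.nonNegative 0≤c}} a≤b)
    (ℚₚ.*-monoˡ-≤-nonNeg b {{ℚ.nonNegative 0≤b}} c≤d)

  0<1 : 0ℚ ℚ.< 1ℚ
  0<1 = ℚₚ.positive⁻¹ 1ℚ

  eventual-bound : ∀ x → IsCauchy x →
    ∃ λ B → 0ℚ ℚ.< B × ∃ λ N → ∀ n → N ℕ.≤ n → ∣ x n ∣ ℚ.≤ B
  eventual-bound x cx with cx 1ℚ 0<1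
  ... | N , close = 1ℚ ℚ.+ ∣ x N ∣ , ℚₚ.+-mono-<-≤ 0<1 (∣∣-nonneg (x N)) , N , bound
    where
    bound : ∀ n → N ℕ.≤ n → ∣ x n ∣ ℚ.≤ 1ℚ ℚ.+ ∣ x N ∣
    bound n N≤n = begin
      ∣ x n ∣                       ≡⟨ cong ∣_∣ (split (x n) (x N)) ⟩
      ∣ (x n ℚ.- x N) ℚ.+ x N ∣     ≤⟨ ℚₚ.∣p+q∣≤∣p∣+∣q∣ (x n ℚ.- x N) (x N) ⟩
      ∣ x n ℚ.- x N ∣ ℚ.+ ∣ x N ∣   ≤⟨ ℚₚ.+-monoˡ-≤ ∣ x N ∣ (close n N N≤n ℕₚ.≤-refl) ⟩
      1ℚ ℚ.+ ∣ x N ∣                ∎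
      where open ℚₚ.≤-Reasoning

  +-cauchy : ∀ x y → IsCauchy x → IsCauchy y → IsCauchy (λ n → x n ℚ.+ y n)
  +-cauchy x y cx cy ε ε>0
    with cx (½ ℚ.* ε) (half-pos ε ε>0) | cy (½ ℚ.* ε) (half-pos ε ε>0)
  ... | M , px | N , py = M ⊔ N , λ m n M⊔N≤m M⊔N≤n → begin
      ∣ (x m ℚ.+ y m) ℚ.- (x n ℚ.+ y n) ∣
        ≡⟨ cong ∣_∣ (rearrange-+ (x m) (y m) (x n) (y n)) ⟩
      ∣ (x m ℚ.- x n) ℚ.+ (y m ℚ.- y n) ∣
        ≤⟨ ℚₚ.∣p+q∣≤∣p∣+∣q∣ (x m ℚ.- x n) (y m ℚ.- y n) ⟩
      ∣ x m ℚ.- x n ∣ ℚ.+ ∣ y m ℚ.- y n ∣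
        ≤⟨ ℚₚ.+-mono-≤
             (px m n (ℕₚ.m⊔n≤o⇒m≤o M N M⊔N≤m) (ℕₚ.m⊔n≤o⇒m≤o M N M⊔N≤n))
             (py m n (ℕₚ.m⊔n≤o⇒n≤o M N M⊔N≤m) (ℕₚ.m⊔n≤o⇒n≤o M N M⊔N≤n)) ⟩
      ½ ℚ.* ε ℚ.+ ½ ℚ.* ε
        ≡⟨ halves ε ⟩
      ε ∎
    where open ℚₚ.≤-Reasoning

  inverse : ∀ C → 0ℚ ℚ.< C → ∃ λ D → 0ℚ ℚ.< D × C ℚ.* D ≡ 1ℚ
  inverse C C>0 = (1/ C) {{nz}} , ℚₚ.positive⁻¹ _ {{ℚₚ.1/pos⇒pos C {{pos}}}} , ℚₚ.*-inverseʳ C {{nz}}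
    where
    pos : ℚ.Positive C
    pos = ℚ.positive C>0
    nz : ℚ.NonZero C
    nz = ℚₚ.pos⇒nonZero C {{pos}}

  share : ∀ C ε → 0ℚ ℚ.< C → 0ℚ ℚ.< ε → ∃ λ δ → 0ℚ ℚ.< δ × C ℚ.* δ ≡ ε
  share C ε C>0 ε>0 with inverse C C>0
  ... | D , D>0 , CD≡1 = D ℚ.* ε , *-pos D>0 ε>0 ,
    trans (sym (ℚₚ.*-assoc C D ε)) (trans (cong (ℚ._* ε) CD≡1) (ℚₚ.*-identityˡ ε))
    where
    *-pos : ∀ {p q} → 0ℚ ℚ.< p → 0ℚ ℚ.< q → 0ℚ ℚ.< p ℚ.* q
    *-pos {p} {q} p>0 q>0 = subst (ℚ._< p ℚ.* q) (ℚₚ.*-zeroʳ p)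
      (ℚₚ.*-monoʳ-<-pos p {{ℚ.positive p>0}} q>0)

  product-close : ∀ {A B δ} a b c d → 0ℚ ℚ.< A → 0ℚ ℚ.< B →
    ∣ a ∣ ℚ.≤ A → ∣ d ∣ ℚ.≤ B → ∣ a ℚ.- c ∣ ℚ.≤ δ → ∣ b ℚ.- d ∣ ℚ.≤ δ →
    ∣ a ℚ.* b ℚ.- c ℚ.* d ∣ ℚ.≤ (A ℚ.+ B) ℚ.* δ
  product-close {A} {B} {δ} a b c d A>0 B>0 a≤A d≤B ac bd = begin
    ∣ a ℚ.* b ℚ.- c ℚ.* d ∣
      ≡⟨ cong ∣_∣ (rearrange-* a b c d) ⟩
    ∣ a ℚ.* (b ℚ.- d) ℚ.+ d ℚ.* (a ℚ.- c) ∣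
      ≤⟨ ℚₚ.∣p+q∣≤∣p∣+∣q∣ (a ℚ.* (b ℚ.- d)) (d ℚ.* (a ℚ.- c)) ⟩
    ∣ a ℚ.* (b ℚ.- d) ∣ ℚ.+ ∣ d ℚ.* (a ℚ.- c) ∣
      ≡⟨ cong₂ ℚ._+_ (ℚₚ.∣p*q∣≡∣p∣*∣q∣ a (b ℚ.- d)) (ℚₚ.∣p*q∣≡∣p∣*∣q∣ d (a ℚ.- c)) ⟩
    ∣ a ∣ ℚ.* ∣ b ℚ.- d ∣ ℚ.+ ∣ d ∣ ℚ.* ∣ a ℚ.- c ∣
      ≤⟨ ℚₚ.+-mono-≤ (*-mono-≤ (ℚₚ.<⇒≤ A>0) (∣∣-nonneg (b ℚ.- d)) a≤A bd)
                     (*-mono-≤ (ℚₚ.<⇒≤ B>0) (∣∣-nonneg (a ℚ.- c)) d≤B ac) ⟩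
    A ℚ.* δ ℚ.+ B ℚ.* δ
      ≡⟨ ℚₚ.*-distribʳ-+ δ A B ⟨
    (A ℚ.+ B) ℚ.* δ ∎
    where open ℚₚ.≤-Reasoning

  *-cauchy : ∀ x y → IsCauchy x → IsCauchy y → IsCauchy (λ n → x n ℚ.* y n)
  *-cauchy x y cx cy ε ε>0 = combine (eventual-bound x cx) (eventual-bound y cy)
    where
    Bounded : (ℕ → ℚ) → Set
    Bounded x = ∃ λ B → 0ℚ ℚ.< B × ∃ λ N → ∀ n → N ℕ.≤ n → ∣ x n ∣ ℚ.≤ B
    combine : Bounded x → Bounded y →
      ∃ λ N → ∀ m n → N ℕ.≤ m → N ℕ.≤ n → ∣ x m ℚ.* y m ℚ.- x n ℚ.* y n ∣ ℚ.≤ ε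
    combine (A , A>0 , K , bx) (B , B>0 , L , by) = finish (share (A ℚ.+ B) ε (ℚₚ.+-mono-< A>0 B>0) ε>0)
      where
      finish : (∃ λ δ → 0ℚ ℚ.< δ × (A ℚ.+ B) ℚ.* δ ≡ ε) →
        ∃ λ N → ∀ m n → N ℕ.≤ m → N ℕ.≤ n → ∣ x m ℚ.* y m ℚ.- x n ℚ.* y n ∣ ℚ.≤ ε
      finish (δ , δ>0 , eq) = K ⊔ L ⊔ (M ⊔ N) , λ m n ≤m ≤n →
        ℚₚ.≤-trans
          (product-close (x m) (y m) (x n) (y n) A>0 B>0
            (bx m (ℕₚ.m⊔n≤o⇒m≤o K L (left ≤m)))
            (by n (ℕₚ.m⊔n≤o⇒n≤o K L (left ≤n)))
            (proj₂ (cx δ δ>0) m n (ℕₚ.m⊔n≤o⇒m≤o M N (right ≤m)) (ℕₚ.m⊔n≤o⇒m≤o M N (right ≤n)))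
            (proj₂ (cy δ δ>0) m n (ℕₚ.m⊔n≤o⇒n≤o M N (right ≤m)) (ℕₚ.m⊔n≤o⇒n≤o M N (right ≤n))))
          (ℚₚ.≤-reflexive eq)
        where
        M N : ℕ
        M = proj₁ (cx δ δ>0)
        N = proj₁ (cy δ δ>0)
        left : ∀ {k} → K ⊔ L ⊔ (M ⊔ N) ℕ.≤ k → K ⊔ L ℕ.≤ k
        left = ℕₚ.m⊔n≤o⇒m≤o (K ⊔ L) (M ⊔ N)
        right : ∀ {k} → K ⊔ L ⊔ (M ⊔ N) ℕ.≤ k → M ⊔ N ℕ.≤ k
        right = ℕₚ.m⊔n≤o⇒n≤o (K ⊔ L) (M ⊔ N)

  const-cauchy : ∀ p → IsCauchy (λ _ → p)
  const-cauchy p ε ε>0 = 0 , λ _ _ _ _ →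
    subst (ℚ._≤ ε) (cong ∣_∣ (sym (ℚₚ.+-inverseʳ p))) (ℚₚ.<⇒≤ ε>0)

infixl 6 _+_
infixl 7 _*_
infixr 8 _^_

fromℚ : ℚ → ℝ
fromℚ p = mkℝ (λ _ → p) (const-cauchy p)

fromℕ : ℕ → ℝ
fromℕ n = fromℚ (+ n ℚ./ 1)

_+_ : ℝ → ℝ → ℝ
x + y = mkℝ (λ n → seq x n ℚ.+ seq y n) (+-cauchy (seq x) (seq y) (cauchy x) (cauchy y))

_*_ : ℝ → ℝ → ℝ
x * y = mkℝ (λ n → seq x n ℚ.* seq y n) (*-cauchy (seq x) (seq y) (cauchy x) (cauchy y))

_^_ : ℝ → ℕ → ℝ
x ^ zero  = fromℕ 1
x ^ suc k = x * x ^ k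

geometricSum : ℝ → ℕ → ℝ
geometricSum x zero    = fromℕ 1
geometricSum x (suc ℓ) = x ^ suc ℓ + geometricSum x ℓ

record Graph (n : ℕ) : Set where
  field
    adj    : Fin n → Fin n → Bool
    symm   : ∀ u v → adj u v ≡ adj v u
    irrefl : ∀ v → adj v v ≡ false

  _~_ : Fin n → Fin n → Set
  u ~ v = T (adj u v)

  Edge : Fin n × Fin n → Set
  Edge (u , v) = u <ᶠ v × u ~ v

  edge? : Decidable Edge
  edge? (u , v) = (u <ᶠ? v) ×-dec T? (adj u v)

  edges : List (Fin n × Fin n)
  edges = filter edge? (cartesianProduct (allFin n) (allFin n))

open Graph public using (adj; symm; irrefl; edges)

∣E_∣ : ∀ {n} → Graph n → ℕ
∣E G ∣ = length (edges G)

Bipartite : ∀ {n} → Graph n → Set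
Bipartite {n} G = ∃ λ (c : Fin n → Bool) → ∀ u v → u ~ v → c u ≢ c v
  where open Graph G using (_~_)

-- H ⊑ G: G has a (not necessarily induced) subgraph isomorphic to H.
IsCopy : ∀ {k n} → Graph k → Graph n → (Fin k → Fin n) → Set
IsCopy H G f = Injective _≡_ _≡_ f × (∀ u v → u H.~ v → f u G.~ f v)
  where
  module H = Graph H
  module G = Graph G

infix 4 _⊑_

_⊑_ : ∀ {k n} → Graph k → Graph n → Set
H ⊑ G = ∃ (IsCopy H G)

HasEdge : ∀ {n} → Graph n → Set
HasEdge {n} G = ∃ λ (u : Fin n) → ∃ λ v → u ~ v
  where open Graph G using (_~_)

-- A forbidden family. Each member is required to have an edge so that the
-- edgeless graph is free of it and the maximum defining z exists.
record Family : Set where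
  field
    members  : List (∃ Graph)
    nonempty : All (λ (_ , H) → HasEdge H) members

open Family public

Free : ∀ {n} → Family → Graph n → Set
Free 𝓕 G = All (λ (_ , H) → ¬ (H ⊑ G)) (members 𝓕)

Attained : ℕ → Family → ℕ → Set
Attained n 𝓕 m = ∃ λ (G : Graph n) → Bipartite G × Free 𝓕 G × ∣E G ∣ ≡ m

IsMaximum : (ℕ → Set) → ℕ → Set
IsMaximum P m = P m × (∀ k → P k → k ℕ.≤ m)

private
  Searchable : Set → Set₁
  Searchable A = ∀ {P : A → Set} → Decidable P → Dec (∃ P)

  search-Bool : Searchable Bool
  search-Bool P? with P? true | P? false
  ... | yes p | _     = yes (true , p)
  ... | no _  | yes p = yes (false , p)
  ... | no ¬t | no ¬f = no λ { (true , p) → ¬t p ; (false , p) → ¬f p }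

  search-Vec : ∀ {A} → Searchable A → ∀ n → Searchable (Vec A n)
  search-Vec s zero P? = map′ (Vec.[] ,_) (λ { (Vec.[] , p) → p }) (P? Vec.[])
  search-Vec s (suc n) P? =
    map′ (λ (a , v , p) → (a Vec.∷ v) , p) (λ { ((a Vec.∷ v) , p) → a , v , p })
      (s (λ a → search-Vec s n (λ v → P? (a Vec.∷ v))))

  search-→ : ∀ {A n} → Searchable A → {P : (Fin n → A) → Set} →
    (∀ {f g} → f ≗ g → P f → P g) → Decidable P → Dec (∃ P)
  search-→ {n = n} s resp P? =
    map′ (λ (v , p) → Vec.lookup v , p)
         (λ (f , p) → Vec.tabulate f , resp (λ i → sym (lookup∘tabulate f i)) p)
         (search-Vec s n (λ v → P? (Vec.lookup v)))

  bipartite? : ∀ {n} (G : Graph n) → Dec (Bipartite G)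
  bipartite? G = search-→ search-Bool
    (λ f≗g c u v e eq → c u v e (trans (f≗g u) (trans eq (sym (f≗g v)))))
    (λ c → all? λ u → all? λ v → T? (adj G u v) →-dec ¬? (c u ≟ᵇ c v))

  _⊑?_ : ∀ {k n} (H : Graph k) (G : Graph n) → Dec (H ⊑ G)
  H ⊑? G = search-→ any?
    (λ {f} {g} f≗g (inj , hom) →
      (λ {u} {v} eq → inj (trans (f≗g u) (trans eq (sym (f≗g v))))) ,
      (λ u v e → subst₂ (λ a b → T (adj G a b)) (f≗g u) (f≗g v) (hom u v e)))
    (λ f → map′ (λ i {u} {v} → i u v) (λ i u v → i {u} {v})
             (all? λ u → all? λ v → (f u ≟ᶠ f v) →-dec (u ≟ᶠ v))
      ×-dec (all? λ u → all? λ v → T? (adj H u v) →-dec T? (adj G (f u) (f v))))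

  free? : ∀ {n} 𝓕 (G : Graph n) → Dec (Free 𝓕 G)
  free? 𝓕 G = All.all? (λ (_ , H) → ¬? (H ⊑? G)) (members 𝓕)

  Good : ∀ {n} → Family → ℕ → Graph n → Set
  Good 𝓕 m G = Bipartite G × Free 𝓕 G × ∣E G ∣ ≡ m

  good? : ∀ {n} 𝓕 m (G : Graph n) → Dec (Good 𝓕 m G)
  good? 𝓕 m G = bipartite? G ×-dec (free? 𝓕 G ×-dec (∣E G ∣ ℕₚ.≟ m))

  good-resp : ∀ {n} 𝓕 m {G H : Graph n} → (∀ u v → adj G u v ≡ adj H u v) →
    Good 𝓕 m G → Good 𝓕 m H
  good-resp {n} 𝓕 m {G} {H} eq ((c , proper) , free , count) =
    (c , λ u v e → proper u v (back u v e)) ,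
    All.map (λ ¬copy (f , inj , hom) → ¬copy (f , inj , λ u v e → back (f u) (f v) (hom u v e))) free ,
    trans (cong length (filter-≐ (Graph.edge? H) (Graph.edge? G)
      ((λ {(u , v)} (l , e) → l , back u v e) ,
       (λ {(u , v)} (l , e) → l , subst T (eq u v) e))
      (cartesianProduct (allFin n) (allFin n)))) count
    where
    back : ∀ u v → T (adj H u v) → T (adj G u v)
    back u v = subst T (sym (eq u v))

  attained? : ∀ n 𝓕 → Decidable (Attained n 𝓕)
  attained? n 𝓕 m = map′ to from (search-Vec (search-Vec search-Bool n) n dec)
    where
    Matrix : Set
    Matrix = Vec (Vec Bool n) n
    entry : Matrix → Fin n → Fin n → Bool
    entry M u v = Vec.lookup (Vec.lookup M u) v
    Symm Irrefl : Matrix → Set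
    Symm M = ∀ u v → entry M u v ≡ entry M v u
    Irrefl M = ∀ v → entry M v v ≡ false
    graph : ∀ M → Symm M → Irrefl M → Graph n
    graph M s i = record { adj = entry M ; symm = s ; irrefl = i }
    Q : Matrix → Set
    Q M = Σ (Symm M) λ s → Σ (Irrefl M) λ i → Good 𝓕 m (graph M s i)
    dec : Decidable Q
    dec M with all? (λ u → all? λ v → entry M u v ≟ᵇ entry M v u)
             | all? (λ v → entry M v v ≟ᵇ false)
    ... | no ¬s | _     = no λ (s , _) → ¬s s
    ... | yes _ | no ¬i = no λ (_ , i , _) → ¬i i
    ... | yes s | yes i = map′ (λ g → s , i , g)
      (λ (s′ , i′ , g) → good-resp 𝓕 m {graph M s′ i′} {graph M s i} (λ _ _ → refl) g)
      (good? 𝓕 m (graph M s i))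
    to : ∃ Q → Attained n 𝓕 m
    to (M , s , i , g) = graph M s i , g
    from : Attained n 𝓕 m → ∃ Q
    from (G , g) = M , s , i , good-resp 𝓕 m {G} {graph M s i} (λ u v → sym (eq u v)) g
      where
      M : Matrix
      M = Vec.tabulate (λ u → Vec.tabulate (adj G u))
      eq : ∀ u v → entry M u v ≡ adj G u v
      eq u v = trans (cong (λ r → Vec.lookup r v) (lookup∘tabulate (λ u → Vec.tabulate (adj G u)) u))
                     (lookup∘tabulate (adj G u) v)
      s : Symm M
      s u v = trans (eq u v) (trans (symm G u v) (sym (eq v u)))
      i : Irrefl M
      i v = trans (eq v v) (irrefl G v)

  edgeless : ∀ n → Graph n
  edgeless n = record { adj = λ _ _ → false ; symm = λ _ _ → refl ; irrefl = λ _ → refl }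

  edgeless-attained : ∀ n 𝓕 → Attained n 𝓕 ∣E edgeless n ∣
  edgeless-attained n 𝓕 = edgeless n , ((λ _ → true) , λ _ _ ()) ,
    All.map (λ (u , v , e) (f , _ , hom) → ⊥-elim (hom u v e)) (nonempty 𝓕) , refl

  maximum : ∀ {P : ℕ → Set} → Decidable P → ∃ P →
    ∀ b → (∀ k → P k → k ℕ.≤ b) → ∃ (IsMaximum P)
  maximum P? (k , p) zero bound with bound k p
  ... | z≤n = zero , p , bound
  maximum {P} P? ex (suc b) bound with P? (suc b)
  ... | yes p = suc b , p , bound
  ... | no ¬p = maximum P? ex b λ k p →
    ℕ.s≤s⁻¹ (ℕₚ.≤∧≢⇒< (bound k p) λ k≡ → ¬p (subst P k≡ p))

maximum-exists : ∀ n 𝓕 → ∃ (IsMaximum (Attained n 𝓕))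
maximum-exists n 𝓕 = maximum (attained? n 𝓕) (_ , edgeless-attained n 𝓕)
  (length (cartesianProduct (allFin n) (allFin n)))
  λ { k (G , _ , _ , refl) → length-filter (Graph.edge? G) (cartesianProduct (allFin n) (allFin n)) }

z : ℕ → Family → ℕ
z n 𝓕 = proj₁ (maximum-exists n 𝓕)

z-isMaximum : ∀ n 𝓕 → IsMaximum (Attained n 𝓕) (z n 𝓕)
z-isMaximum n 𝓕 = proj₂ (maximum-exists n 𝓕)

next : ∀ {j} → Fin j → Fin j → Bool
next {suc j} u v = suc (toℕ u) % suc j ≡ᵇ toℕ v

private
  next-irrefl : ∀ {j} → 3 ℕ.≤ j → (v : Fin j) → next v v ≡ false
  next-irrefl {suc (suc j)} (s≤s (s≤s _)) v with ℕₚ.m≤n⇒m<n∨m≡n (toℕ<n v)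
  ... | inj₁ v+1<j = trans (cong (_≡ᵇ toℕ v) (m<n⇒m%n≡m v+1<j)) (1+n≢ᵇn (toℕ v))
    where
    1+n≢ᵇn : ∀ n → (suc n ≡ᵇ n) ≡ false
    1+n≢ᵇn zero    = refl
    1+n≢ᵇn (suc n) = 1+n≢ᵇn n
  ... | inj₂ v+1≡j = trans
    (cong₂ _≡ᵇ_ (trans (cong (_% suc (suc j)) v+1≡j) (n%n≡0 (suc (suc j)))) (ℕₚ.suc-injective v+1≡j))
    refl

cycle : ∀ j → 3 ℕ.≤ j → Graph j
cycle j 3≤j = record
  { adj    = λ u v → next u v ∨ next v u
  ; symm   = λ u v → ∨-comm (next u v) (next v u)
  ; irrefl = λ v → cong₂ _∨_ (next-irrefl 3≤j v) (next-irrefl 3≤j v)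
  }

private
  cycle-hasEdge : ∀ {j} (3≤j : 3 ℕ.≤ j) → HasEdge (cycle j 3≤j)
  cycle-hasEdge {suc (suc (suc j))} (s≤s (s≤s (s≤s z≤n))) = zero , suc zero , tt

  3≤2*[2+i] : ∀ i → 3 ℕ.≤ 2 ℕ.* (2 ℕ.+ i)
  3≤2*[2+i] i = ℕₚ.≤-trans (ℕₚ.n≤1+n 3) (ℕₚ.*-monoʳ-≤ 2 (s≤s (s≤s (z≤n {i}))))

-- 𝓒 ℓ is {C₄, C₆, …, C₂ₗ}: the members are the cycles of length 2 (2 + i)
-- for 0 ≤ i < ℓ ∸ 1.
𝓒 : ℕ → Family
𝓒 ℓ = record
  { members  = map (λ i → 2 ℕ.* (2 ℕ.+ i) , cycle (2 ℕ.* (2 ℕ.+ i)) (3≤2*[2+i] i)) (upTo (ℓ ∸ 1))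
  ; nonempty = map⁺ (All.universal (λ i → cycle-hasEdge (3≤2*[2+i] i)) (upTo (ℓ ∸ 1)))
  }

module Submission where

-- Delete vertices of degree one until none is left. If no edge survives, G is
-- a forest and has fewer edges than vertices. Otherwise let t + 1 ≥ 2 be the
-- average degree of what remains. Every vertex is the end of at most one
-- non-backtracking walk with at most ℓ further steps from a given edge (in
-- either direction), since two such walks would close up to an even cycle of
-- length at most 2ℓ. On the other hand the uniform distribution on directed
-- edges is stationary for the non-backtracking walk, so by Jensen's inequality
-- there are on average at least tᵏ walks with k further steps
-- (Alon, Hoory and Linial). Hence 2 (tˡ + … + 1) ≤ n, which gives t ≤ q.
-- Jensen's inequality for log is replaced by 1+sumOf-φ≤product, which holds
-- over ℚ.

-- Why `φ` has its form: put y = (d - 1) / t for a vertex of degree d. The denominator t * y + 1 of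
-- `φ` is then d, so d * φ y = (t + 1) * (y - 1) is affine in d. It is the tangent at d = t + 1 to d
-- * log ((d - 1) / t), which is convex for d at least 2. Summed over directed edges it therefore
-- vanishes exactly when the average degree is t + 1, with no convexity argument left at this point.
-- The price is paid elsewhere: the bound of a product from below by 1 plus a sum of values of `φ`
-- has to be proved by algebra alone.
--
-- A forest is not harmless when q < 1, since then (q + 1) / 2 * n lies below n. What saves the
-- bound is (1 - q) * n = 2 * (1 - q ^ (ℓ + 1)), which is less than 2, so that n - 1 edges are still
-- few enough.
--
-- At a given index of its Cauchy sequence q is only a rational x, for which the equation for n
-- holds up to some δ. All estimates are therefore made for rational x with an explicit additive
-- error, and the passage to q comes last.

module RationalInequalities where
  open import Data.List using (List; []; _∷_; foldr)
  open import Data.List.Relation.Unary.All using (All; []; _∷_)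
  open import Data.Product using (∃; _×_; _,_; proj₂)
  open import Data.Rational
  open import Data.Rational.Properties
  open import Data.Rational.Solver using (module +-*-Solver)
  open import Data.Sum using (_⊎_; inj₁; inj₂)
  open import Relation.Binary.PropositionalEquality
    using (_≡_; _≢_; refl; sym; trans; cong; cong₂; subst; module ≡-Reasoning)
  open import Relation.Nullary using (¬_; yes; no; contradiction)
  open +-*-Solver

  2ℚ : ℚ
  2ℚ = 1ℚ + 1ℚ

  0≤1 : 0ℚ ≤ 1ℚ
  0≤1 = nonNegative⁻¹ 1ℚ

  0<1 : 0ℚ < 1ℚ
  0<1 = positive⁻¹ 1ℚ

  0≤2 : 0ℚ ≤ 2ℚ
  0≤2 = nonNegative⁻¹ 2ℚ

  <⇒≱ : ∀ {p q} → p < q → ¬ (q ≤ p)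
  <⇒≱ p<q q≤p = <-irrefl refl (<-≤-trans p<q q≤p)

  p≤p+d : ∀ {p q} d → 0ℚ ≤ d → q ≡ p + d → p ≤ q
  p≤p+d {p} {q} d 0≤d eq = begin
    p       ≡⟨ +-identityʳ p ⟨
    p + 0ℚ  ≤⟨ +-monoʳ-≤ p 0≤d ⟩
    p + d   ≡⟨ eq ⟨
    q       ∎
    where open ≤-Reasoning

  p≤q⇒0≤q-p : ∀ {p q} → p ≤ q → 0ℚ ≤ q - p
  p≤q⇒0≤q-p {p} {q} p≤q = subst (_≤ q - p) (+-inverseʳ p) (+-monoˡ-≤ (- p) p≤q)

  *-monoˡ-≤ : ∀ {p q} r → 0ℚ ≤ r → p ≤ q → r * p ≤ r * q
  *-monoˡ-≤ r 0≤r = *-monoˡ-≤-nonNeg r {{nonNegative 0≤r}}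

  *-mono-≤ : ∀ {p q r s} → 0ℚ ≤ q → 0ℚ ≤ r → p ≤ q → r ≤ s → p * r ≤ q * s
  *-mono-≤ {q = q} {r = r} 0≤q 0≤r p≤q r≤s = ≤-trans
    (*-monoʳ-≤-nonNeg r {{nonNegative 0≤r}} p≤q) (*-monoˡ-≤ q 0≤q r≤s)

  0≤p*q : ∀ {p q} → 0ℚ ≤ p → 0ℚ ≤ q → 0ℚ ≤ p * q
  0≤p*q {p} {q} 0≤p 0≤q = subst (_≤ p * q) (*-zeroʳ p) (*-monoˡ-≤ p 0≤p 0≤q)

  0≤p+q : ∀ {p q} → 0ℚ ≤ p → 0ℚ ≤ q → 0ℚ ≤ p + q
  0≤p+q = +-mono-≤

  0≤p*p : ∀ p → 0ℚ ≤ p * p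
  0≤p*p p with ≤-total 0ℚ p
  ... | inj₁ 0≤p = 0≤p*q 0≤p 0≤p
  ... | inj₂ p≤0 = subst (0ℚ ≤_) (solve 1 (λ p → (:- p) :* (:- p) := p :* p) refl p)
    (0≤p*q (neg-antimono-≤ p≤0) (neg-antimono-≤ p≤0))

  -- recip 0 = 0.
  recip : ℚ → ℚ
  recip p with p ≟ 0ℚ
  ... | yes _  = 0ℚ
  ... | no p≢0 = (1/ p) {{≢-nonZero p≢0}}

  *-recipʳ : ∀ {p} → p ≢ 0ℚ → p * recip p ≡ 1ℚ
  *-recipʳ {p} p≢0 with p ≟ 0ℚ
  ... | yes p≡0 = contradiction p≡0 p≢0
  ... | no p≢0′ = *-inverseʳ p {{≢-nonZero p≢0′}}

  *-recipʳ-pos : ∀ {p} → 0ℚ < p → p * recip p ≡ 1ℚ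
  *-recipʳ-pos 0<p = *-recipʳ λ p≡0 → <-irrefl (sym p≡0) 0<p

  0≤recip : ∀ {p} → 0ℚ ≤ p → 0ℚ ≤ recip p
  0≤recip {p} 0≤p with p ≟ 0ℚ
  ... | yes _  = ≤-refl
  ... | no p≢0 = <⇒≤ (positive⁻¹ ((1/ p) {{≢-nonZero p≢0}}) {{1/pos⇒pos p {{p-positive}}}})
    where
    p-positive : Positive p
    p-positive = nonNeg∧nonZero⇒pos p {{nonNegative 0≤p}} {{≢-nonZero p≢0}}

  -- A rational substitute for the logarithm: products bounded below by sums.

  sumOf : (ℚ → ℚ) → List ℚ → ℚ
  sumOf f []       = 0ℚ
  sumOf f (y ∷ ys) = f y + sumOf f ys

  product : List ℚ → ℚ
  product = foldr _*_ 1ℚ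

  -- φ is a rational lower bound for log on [1 / t, ∞), touching it at 1.
  module LogBound (t : ℚ) (1≤t : 1ℚ ≤ t) where

    Admissible : ℚ → Set
    Admissible y = 1ℚ ≤ t * y

    φ : ℚ → ℚ
    φ y = (t + 1ℚ) * (y - 1ℚ) * recip (t * y + 1ℚ)

    0≤t : 0ℚ ≤ t
    0≤t = ≤-trans 0≤1 1≤t

    admissible⇒0≤ : ∀ {y} → Admissible y → 0ℚ ≤ y
    admissible⇒0≤ {y} 1≤ty with ≤-total 0ℚ y
    ... | inj₁ 0≤y = 0≤y
    ... | inj₂ y≤0 = contradiction
      (≤-trans 1≤ty (≤-trans (*-monoˡ-≤ t 0≤t y≤0) (≤-reflexive (*-zeroʳ t)))) (<⇒≱ 0<1)

    0≤t+1 : 0ℚ ≤ t + 1ℚ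
    0≤t+1 = 0≤p+q 0≤t 0≤1

    module _ {y : ℚ} (1≤ty : Admissible y) where
      0<ty+1 : 0ℚ < t * y + 1ℚ
      0<ty+1 = +-mono-≤-< (≤-trans 0≤1 1≤ty) 0<1

      unit : (t * y + 1ℚ) * recip (t * y + 1ℚ) ≡ 1ℚ
      unit = *-recipʳ-pos 0<ty+1

      0≤recip-ty+1 : 0ℚ ≤ recip (t * y + 1ℚ)
      0≤recip-ty+1 = 0≤recip (<⇒≤ 0<ty+1)

      -- The difference of the two sides is t * (y - 1)² / (t * y + 1).
      φ≤y-1 : φ y ≤ y - 1ℚ
      φ≤y-1 = p≤p+d (t * recip (t * y + 1ℚ) * ((y - 1ℚ) * (y - 1ℚ)))
        (0≤p*q (0≤p*q 0≤t 0≤recip-ty+1) (0≤p*p (y - 1ℚ)))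
        (begin
          y - 1ℚ
            ≡⟨ *-identityʳ (y - 1ℚ) ⟨
          (y - 1ℚ) * 1ℚ
            ≡⟨ cong ((y - 1ℚ) *_) unit ⟨
          (y - 1ℚ) * ((t * y + 1ℚ) * recip (t * y + 1ℚ))
            ≡⟨ solve 3 (λ t y r → (y :- con 1ℚ) :* ((t :* y :+ con 1ℚ) :* r)
                 := (t :+ con 1ℚ) :* (y :- con 1ℚ) :* r :+ t :* r :* ((y :- con 1ℚ) :* (y :- con 1ℚ)))
                 refl t y (recip (t * y + 1ℚ)) ⟩
          φ y + t * recip (t * y + 1ℚ) * ((y - 1ℚ) * (y - 1ℚ)) ∎)
        where open ≡-Reasoning

    module _ {a b : ℚ} (ta : Admissible a) (tb : Admissible b) (1≤a : 1ℚ ≤ a) (b≤1 : b ≤ 1ℚ) where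
      private
        rᵃ rᵇ rᵃᵇ gain : ℚ
        rᵃ = recip (t * a + 1ℚ)
        rᵇ = recip (t * b + 1ℚ)
        rᵃᵇ = recip (t * (a * b) + 1ℚ)
        gain = (t + 1ℚ) * ((a - 1ℚ) * (1ℚ - b) * ((t * a) * (t * b) - 1ℚ)) * (rᵃ * rᵇ * rᵃᵇ)

      admissible-* : Admissible (a * b)
      admissible-* = ≤-trans tb (*-monoˡ-≤ t 0≤t
        (p≤p+d ((a - 1ℚ) * b) (0≤p*q (p≤q⇒0≤q-p 1≤a) (admissible⇒0≤ tb))
          (solve 2 (λ a b → a :* b := b :+ (a :- con 1ℚ) :* b) refl a b)))

      -- After t y = eˣ this is convexity of 1 / (eˣ + 1) on x ≥ 0: the pair
      -- a, b is more spread out than the pair a b, 1.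
      φ-merge : φ a + φ b ≤ φ (a * b)
      φ-merge = p≤p+d gain
        (0≤p*q (0≤p*q 0≤t+1 (0≤p*q (0≤p*q (p≤q⇒0≤q-p 1≤a) (p≤q⇒0≤q-p b≤1))
                (p≤q⇒0≤q-p (≤-trans (≤-reflexive (sym (*-identityˡ 1ℚ)))
                  (*-mono-≤ (≤-trans 0≤1 ta) 0≤1 ta tb)))))
               (0≤p*q (0≤p*q (0≤recip-ty+1 ta) (0≤recip-ty+1 tb)) (0≤recip-ty+1 admissible-*)))
        (begin
          φ (a * b)
            -- Each value of `φ` is multiplied by the two units built from the other denominators.
            -- What remains is a polynomial identity in which the three reciprocals are independent
            -- variables.
            ≡⟨ pad (φ (a * b)) (unit ta) (unit tb) ⟩
          φ (a * b) * (((t * a + 1ℚ) * rᵃ) * ((t * b + 1ℚ) * rᵇ))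
            ≡⟨ solve 6 (λ t a b r s u →
                 (t :+ con 1ℚ) :* (a :* b :- con 1ℚ) :* u
                   :* (((t :* a :+ con 1ℚ) :* r) :* ((t :* b :+ con 1ℚ) :* s))
                 := (t :+ con 1ℚ) :* (a :- con 1ℚ) :* r
                      :* (((t :* b :+ con 1ℚ) :* s) :* ((t :* (a :* b) :+ con 1ℚ) :* u))
                    :+ (t :+ con 1ℚ) :* (b :- con 1ℚ) :* s
                      :* (((t :* a :+ con 1ℚ) :* r) :* ((t :* (a :* b) :+ con 1ℚ) :* u))
                    :+ (t :+ con 1ℚ) :* ((a :- con 1ℚ) :* (con 1ℚ :- b) :* ((t :* a) :* (t :* b) :- con 1ℚ))
                      :* (r :* s :* u))
                 refl t a b rᵃ rᵇ rᵃᵇ ⟩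
          φ a * (((t * b + 1ℚ) * rᵇ) * ((t * (a * b) + 1ℚ) * rᵃᵇ))
            + φ b * (((t * a + 1ℚ) * rᵃ) * ((t * (a * b) + 1ℚ) * rᵃᵇ)) + gain
            ≡⟨ cong (_+ gain) (cong₂ _+_ (pad (φ a) (unit tb) (unit admissible-*))
                                         (pad (φ b) (unit ta) (unit admissible-*))) ⟨
          φ a + φ b + gain ∎)
        where
        open ≡-Reasoning
        pad : ∀ p {x y} → x ≡ 1ℚ → y ≡ 1ℚ → p ≡ p * (x * y)
        pad p refl refl = sym (trans (cong (p *_) (*-identityˡ 1ℚ)) (*-identityʳ p))

    -- The Weierstrass inequality, 1 plus the sum of all y - 1 is at most the product, holds if the
    -- factors lie on one side of 1 and may fail otherwise, for example for 2 and 1/2. Hence a list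
    -- is first brought into this shape.
    OneSided : List ℚ → Set
    OneSided ys = All (1ℚ ≤_) ys ⊎ All (_≤ 1ℚ) ys

    Dominates : List ℚ → List ℚ → Set
    Dominates zs ys = All Admissible zs × OneSided zs × product zs ≡ product ys × sumOf φ ys ≤ sumOf φ zs

    merge-step : ∀ {c zs} a b ys → c ≡ a * b → φ a + φ b ≤ φ c →
      Dominates zs (c ∷ ys) → Dominates zs (a ∷ b ∷ ys)
    merge-step {c} {zs} a b ys eq φ≤ (adm , side , prod , sum≤) = adm , side ,
      trans prod (trans (cong (_* product ys) eq) (*-assoc a b (product ys))) ,
      (begin
        φ a + (φ b + sumOf φ ys)  ≡⟨ +-assoc (φ a) (φ b) (sumOf φ ys) ⟨
        φ a + φ b + sumOf φ ys    ≤⟨ +-monoˡ-≤ (sumOf φ ys) φ≤ ⟩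
        φ c + sumOf φ ys          ≤⟨ sum≤ ⟩
        sumOf φ zs                ∎)
      where open ≤-Reasoning

    -- If y lies on the other side of 1 than the list, it is merged with the head, which keeps the
    -- product and by `φ-merge` does not lower the sum. The merged factor may fall on either side of
    -- 1, so it is inserted again, into a shorter list.
    insert : ∀ y ys → Admissible y → All Admissible ys → OneSided ys → ∃ λ zs → Dominates zs (y ∷ ys)
    insert y ys ty tys side with ≤-total 1ℚ y
    insert y ys ty tys (inj₁ ≥1) | inj₁ 1≤y = y ∷ ys , ty ∷ tys , inj₁ (1≤y ∷ ≥1) , refl , ≤-refl
    insert y ys ty tys (inj₂ ≤1) | inj₂ y≤1 = y ∷ ys , ty ∷ tys , inj₂ (y≤1 ∷ ≤1) , refl , ≤-refl
    insert y [] ty [] _ | inj₁ 1≤y = y ∷ [] , ty ∷ [] , inj₁ (1≤y ∷ []) , refl , ≤-refl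
    insert y [] ty [] _ | inj₂ y≤1 = y ∷ [] , ty ∷ [] , inj₂ (y≤1 ∷ []) , refl , ≤-refl
    insert y (b ∷ ys) ty (tb ∷ tys) (inj₂ (b≤1 ∷ ≤1)) | inj₁ 1≤y =
      let zs , dom = insert (y * b) ys (admissible-* ty tb 1≤y b≤1) tys (inj₂ ≤1)
      in zs , merge-step y b ys refl (φ-merge ty tb 1≤y b≤1) dom
    insert y (a ∷ ys) ty (ta ∷ tys) (inj₁ (1≤a ∷ ≥1)) | inj₂ y≤1 =
      let zs , dom = insert (a * y) ys (admissible-* ta ty 1≤a y≤1) tys (inj₁ ≥1)
      in zs , merge-step y a ys (*-comm a y)
           (≤-trans (≤-reflexive (+-comm (φ y) (φ a))) (φ-merge ta ty 1≤a y≤1)) dom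

    oneSided : ∀ ys → All Admissible ys → ∃ λ zs → Dominates zs ys
    oneSided [] [] = [] , [] , inj₁ [] , refl , ≤-refl
    oneSided (y ∷ ys) (ty ∷ tys) =
      let zs , adm , side , prod , sum≤ = oneSided ys tys
          ws , adm′ , side′ , prod′ , sum≤′ = insert y zs ty adm side
      in ws , adm′ , side′ , trans prod′ (cong (y *_) prod) , ≤-trans (+-monoʳ-≤ (φ y) sum≤) sum≤′

    -- From y * p = (y - 1) + p + (y - 1) * (p - 1), where the last term may be dropped when y and p
    -- are on the same side of 1.
    weierstrass-step : ∀ {y p s} → Admissible y → 0ℚ ≤ (y - 1ℚ) * (p - 1ℚ) →
      1ℚ + s ≤ p → 1ℚ + (φ y + s) ≤ y * p
    weierstrass-step {y} {p} {s} ty same-sign ih = begin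
      1ℚ + (φ y + s)       ≤⟨ +-monoʳ-≤ 1ℚ (+-monoˡ-≤ s (φ≤y-1 ty)) ⟩
      1ℚ + (y - 1ℚ + s)    ≡⟨ solve 2 (λ y s → con 1ℚ :+ (y :- con 1ℚ :+ s) := y :- con 1ℚ :+ (con 1ℚ :+ s)) refl y s ⟩
      y - 1ℚ + (1ℚ + s)    ≤⟨ +-monoʳ-≤ (y - 1ℚ) ih ⟩
      y - 1ℚ + p           ≤⟨ p≤p+d ((y - 1ℚ) * (p - 1ℚ)) same-sign
                                (solve 2 (λ y p → y :* p := y :- con 1ℚ :+ p :+ (y :- con 1ℚ) :* (p :- con 1ℚ)) refl y p) ⟩
      y * p                ∎
      where open ≤-Reasoning

    bound-≥1 : ∀ ys → All Admissible ys → All (1ℚ ≤_) ys → 1ℚ ≤ product ys × 1ℚ + sumOf φ ys ≤ product ys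
    bound-≥1 [] [] [] = ≤-refl , ≤-refl
    bound-≥1 (y ∷ ys) (ty ∷ tys) (1≤y ∷ ≥1) =
      let 1≤p , ih = bound-≥1 ys tys ≥1
      in ≤-trans (≤-reflexive (sym (*-identityˡ 1ℚ))) (*-mono-≤ (≤-trans 0≤1 1≤y) 0≤1 1≤y 1≤p) ,
         weierstrass-step ty (0≤p*q (p≤q⇒0≤q-p 1≤y) (p≤q⇒0≤q-p 1≤p)) ih

    bound-≤1 : ∀ ys → All Admissible ys → All (_≤ 1ℚ) ys →
      0ℚ ≤ product ys × product ys ≤ 1ℚ × 1ℚ + sumOf φ ys ≤ product ys
    bound-≤1 [] [] [] = 0≤1 , ≤-refl , ≤-refl
    bound-≤1 (y ∷ ys) (ty ∷ tys) (y≤1 ∷ ≤1) =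
      let 0≤p , p≤1 , ih = bound-≤1 ys tys ≤1
          0≤y = admissible⇒0≤ ty
      in 0≤p*q 0≤y 0≤p ,
         ≤-trans (*-mono-≤ 0≤1 0≤p y≤1 p≤1) (≤-reflexive (*-identityˡ 1ℚ)) ,
         weierstrass-step ty
           (subst (0ℚ ≤_) (solve 2 (λ y p → (con 1ℚ :- y) :* (con 1ℚ :- p) := (y :- con 1ℚ) :* (p :- con 1ℚ)) refl y (product ys))
             (0≤p*q (p≤q⇒0≤q-p y≤1) (p≤q⇒0≤q-p p≤1)))
           ih

    -- Over the reals this would be the chain: the sum of `φ` is at most the sum of logarithms,
    -- which is the logarithm of the product, which is at most the product minus 1.
    1+sumOf-φ≤product : ∀ ys → All Admissible ys → 1ℚ + sumOf φ ys ≤ product ys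
    1+sumOf-φ≤product ys tys with oneSided ys tys
    ... | zs , adm , side , prod , sum≤ =
      ≤-trans (+-monoʳ-≤ 1ℚ sum≤) (≤-trans (bound side) (≤-reflexive prod))
      where
      bound : OneSided zs → 1ℚ + sumOf φ zs ≤ product zs
      bound (inj₁ ≥1) = proj₂ (bound-≥1 zs adm ≥1)
      bound (inj₂ ≤1) = proj₂ (proj₂ (bound-≤1 zs adm ≤1))

-- Finite sums of rationals and indicator functions.

module FiniteSums where
  open import Algebra.Bundles using (CommutativeRing)
  open import Data.Bool using (Bool; true; false; T; _∧_)
  open import Data.Fin using (Fin; zero; suc; _≟_)
  open import Data.Nat using (ℕ; zero; suc)
  open import Data.Rational hiding (_≟_)
  open import Data.Rational.Properties hiding (_≟_)
  open import Relation.Binary.PropositionalEquality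
    using (_≡_; refl; sym; trans; cong)
  open import Relation.Nullary using (does)
  open CommutativeRing +-*-commutativeRing using (semiring)
  import Algebra.Properties.Semiring.Sum semiring as ∑
  open import Algebra.Properties.Semiring.Exp semiring public using (_^_)
  open RationalInequalities

  ι : ℕ → ℚ
  ι zero    = 0ℚ
  ι (suc n) = 1ℚ + ι n

  geometric : ℚ → ℕ → ℚ
  geometric t zero    = 1ℚ
  geometric t (suc k) = t ^ suc k + geometric t k

  -- Opaque because unification does not solve for the summand once sums of
  -- rationals are allowed to unfold.
  opaque
    sum : ∀ {n} → (Fin n → ℚ) → ℚ
    sum = ∑.sum

    sum-cong : ∀ {n} {f g : Fin n → ℚ} → (∀ i → f i ≡ g i) → sum f ≡ sum g
    sum-cong = ∑.sum-cong-≗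

    sum-mono : ∀ {n} {f g : Fin n → ℚ} → (∀ i → f i ≤ g i) → sum f ≤ sum g
    sum-mono {zero}  f≤g = ≤-refl
    sum-mono {suc n} f≤g = +-mono-≤ (f≤g zero) (sum-mono (λ i → f≤g (suc i)))

    sum-+ : ∀ {n} {f g h : Fin n → ℚ} → (∀ i → h i ≡ f i + g i) → sum h ≡ sum f + sum g
    sum-+ {f = f} {g} h≡ = trans (sum-cong h≡) (∑.∑-distrib-+ f g)

    sum-* : ∀ {n} c {f h : Fin n → ℚ} → (∀ i → h i ≡ c * f i) → sum h ≡ c * sum f
    sum-* c {f} h≡ = trans (sum-cong h≡) (sym (∑.*-distribˡ-sum c f))

    sum-swap : ∀ {m n} (f : Fin m → Fin n → ℚ) → (sum λ i → sum λ j → f i j) ≡ (sum λ j → sum λ i → f i j)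
    sum-swap = ∑.∑-comm

    sum-1 : ∀ n → sum {n} (λ _ → 1ℚ) ≡ ι n
    sum-1 zero    = refl
    sum-1 (suc n) = cong (1ℚ +_) (sum-1 n)

    sum-0 : ∀ {n} {f : Fin n → ℚ} → (∀ i → f i ≡ 0ℚ) → sum f ≡ 0ℚ
    sum-0 {n} f≡0 = trans (sum-cong f≡0) (∑.sum-replicate-zero n)

    sum-suc : ∀ {n} (f : Fin (suc n) → ℚ) → sum f ≡ f zero + sum λ i → f (suc i)
    sum-suc f = refl

  𝟙 : Bool → ℚ
  𝟙 true  = 1ℚ
  𝟙 false = 0ℚ

  0≤𝟙 : ∀ b → 0ℚ ≤ 𝟙 b
  0≤𝟙 true  = 0≤1
  0≤𝟙 false = ≤-refl

  𝟙*-mono : ∀ b {p q} → (T b → p ≤ q) → 𝟙 b * p ≤ 𝟙 b * q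
  𝟙*-mono true  {p} {q} p≤q = *-monoˡ-≤ 1ℚ 0≤1 (p≤q _)
  𝟙*-mono false {p} {q} _   = ≤-reflexive (trans (*-zeroˡ p) (sym (*-zeroˡ q)))

  𝟙*-cong : ∀ b {p q} → (T b → p ≡ q) → 𝟙 b * p ≡ 𝟙 b * q
  𝟙*-cong true  p≡q = cong (1ℚ *_) (p≡q _)
  𝟙*-cong false {p} {q} _ = trans (*-zeroˡ p) (sym (*-zeroˡ q))

  𝟙*𝟙 : ∀ b c → 𝟙 b * 𝟙 c ≡ 𝟙 (b ∧ c)
  𝟙*𝟙 true  c = *-identityˡ (𝟙 c)
  𝟙*𝟙 false c = *-zeroˡ (𝟙 c)

  δ : ∀ {n} → Fin n → Fin n → ℚ
  δ i j = 𝟙 (does (i ≟ j))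

  sum-δ : ∀ {n} (i : Fin n) → sum (δ i) ≡ 1ℚ
  sum-δ zero    = trans (sum-suc (δ zero)) (trans (cong (1ℚ +_) (sum-0 λ _ → refl)) (+-identityʳ 1ℚ))
  sum-δ (suc i) = trans (sum-suc (δ (suc i))) (trans (+-identityˡ (sum (δ i))) (sum-δ i))

-- Counting non-backtracking walks and their growth rate.

module NonBacktrackingWalks where
  open import Data.Bool using (Bool; true; false; T; not; _∧_)
  open import Data.Bool.Properties using (∧-comm; T-∧)
  open import Data.Empty using (⊥-elim)
  open import Data.Fin using (Fin; zero; suc; _≟_)
  open import Data.List using (List; []; _∷_)
  open import Data.List.Relation.Unary.All using (All; []; _∷_)
  open import Data.Nat using (ℕ; zero; suc)
  open import Data.Product using (_,_; proj₁)
  open import Data.Rational hiding (_≟_)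
  open import Data.Rational.Properties hiding (_≟_)
  open import Data.Rational.Solver using (module +-*-Solver)
  open import Function using (Equivalence)
  open import Relation.Binary.PropositionalEquality
    using (_≡_; _≢_; refl; sym; trans; cong; cong₂; subst; module ≡-Reasoning)
  open import Relation.Nullary using (does; yes; no)
  open import Defs using (Graph; adj; symm)
  open RationalInequalities
  open FiniteSums
  open +-*-Solver

  module Counting {n : ℕ} (G : Graph n) where

    infix 4 _~_
    _~_ : Fin n → Fin n → Set
    u ~ v = T (adj G u v)

    a : Fin n → Fin n → ℚ
    a u v = 𝟙 (adj G u v)

    succᵇ : Fin n → Fin n → Fin n → Bool
    succᵇ u v w = adj G v w ∧ not (does (u ≟ w))

    s : Fin n → Fin n → Fin n → ℚ
    s u v w = 𝟙 (succᵇ u v w)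

    degree : Fin n → ℚ
    degree v = sum (a v)

    -- The number of non-isolated vertices, since recip 0 = 0.
    support : ℚ
    support = sum λ v → degree v * recip (degree v)

    ∑∑ : (Fin n → Fin n → ℚ) → ℚ
    ∑∑ f = sum λ u → sum λ v → f u v

    degreeSum : ℚ
    degreeSum = ∑∑ a

    walks : ℕ → Fin n → Fin n → ℚ
    walks zero    u v = 1ℚ
    walks (suc k) u v = sum λ w → s u v w * walks k v w

    -- Recursive in the first step rather than a sum of `walks j` over j up to k, so that the count
    -- can later be split by end vertex along the same recursion; `shortWalks-suc` reconciles the
    -- two forms.
    shortWalks : ℕ → Fin n → Fin n → ℚ
    shortWalks zero    u v = 1ℚ
    shortWalks (suc k) u v = 1ℚ + sum λ w → s u v w * shortWalks k v w

    ~-sym : ∀ {u v} → u ~ v → v ~ u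
    ~-sym {u} {v} = subst T (symm G u v)

    succᵇ⇒~ : ∀ u v w → T (succᵇ u v w) → v ~ w
    succᵇ⇒~ u v w t = proj₁ (Equivalence.to T-∧ t)

    ∑∑-cong : ∀ {f g} → (∀ u v → f u v ≡ g u v) → ∑∑ f ≡ ∑∑ g
    ∑∑-cong f≡g = sum-cong λ u → sum-cong (f≡g u)

    ∑∑-mono : ∀ {f g} → (∀ u v → f u v ≤ g u v) → ∑∑ f ≤ ∑∑ g
    ∑∑-mono f≤g = sum-mono λ u → sum-mono (f≤g u)

    ∑∑-+ : ∀ f g → ∑∑ (λ u v → f u v + g u v) ≡ ∑∑ f + ∑∑ g
    ∑∑-+ f g = sum-+ λ u → sum-+ λ v → refl

    ∑∑-* : ∀ c f → ∑∑ (λ u v → c * f u v) ≡ c * ∑∑ f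
    ∑∑-* c f = sum-* c λ u → sum-* c λ v → refl

    shortWalks-suc : ∀ k u v → shortWalks (suc k) u v ≡ walks (suc k) u v + shortWalks k u v
    shortWalks-suc zero u v = +-comm 1ℚ (walks 1 u v)
    shortWalks-suc (suc k) u v = begin
      1ℚ + sum (λ w → s u v w * shortWalks (suc k) v w)
        ≡⟨ cong (1ℚ +_) (sum-+ λ w → trans (cong (s u v w *_) (shortWalks-suc k v w))
             (*-distribˡ-+ (s u v w) (walks (suc k) v w) (shortWalks k v w))) ⟩
      1ℚ + (walks (suc (suc k)) u v + sum (λ w → s u v w * shortWalks k v w))
        ≡⟨ solve 3 (λ x y z → x :+ (y :+ z) := y :+ (x :+ z)) refl 1ℚ (walks (suc (suc k)) u v) (sum λ w → s u v w * shortWalks k v w) ⟩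
      walks (suc (suc k)) u v + shortWalks (suc k) u v ∎
      where open ≡-Reasoning

    -- The only neighbour of v that cannot follow is u, so adding the indicator of u restores the
    -- whole neighbourhood.
    sum-s : ∀ {u v} → u ~ v → sum (s u v) ≡ degree v - 1ℚ
    sum-s {u} {v} u~v = begin
      sum (s u v)                     ≡⟨ solve 1 (λ x → x := x :+ con 1ℚ :- con 1ℚ) refl (sum (s u v)) ⟩
      sum (s u v) + 1ℚ - 1ℚ           ≡⟨ cong (λ x → sum (s u v) + x - 1ℚ) (sum-δ u) ⟨
      sum (s u v) + sum (δ u) - 1ℚ    ≡⟨ cong (_- 1ℚ) (sum-+ λ w → refl) ⟨
      sum (λ w → s u v w + δ u w) - 1ℚ ≡⟨ cong (_- 1ℚ) (sum-cong split) ⟩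
      degree v - 1ℚ                   ∎
      where
      open ≡-Reasoning
      𝟙-T : ∀ {b} → T b → 1ℚ ≡ 𝟙 b
      𝟙-T {true} _ = refl
      split : ∀ w → s u v w + δ u w ≡ a v w
      split w with u ≟ w
      ... | no _ = trans (+-identityʳ (𝟙 (adj G v w ∧ true))) (cong 𝟙 (∧-comm (adj G v w) true))
      ... | yes refl = trans (cong (_+ 1ℚ) (cong 𝟙 (∧-comm (adj G v u) false))) (trans (+-identityˡ 1ℚ) (𝟙-T (~-sym u~v)))

    -- The path u, v, w is read backwards. This turns a sum over predecessors into one over
    -- successors, which `sum-s` evaluates.
    a*s-reverse : ∀ u v w → a u v * s u v w ≡ a w v * s w v u
    a*s-reverse u v w = begin
      a u v * s u v w                              ≡⟨ 𝟙*𝟙 (adj G u v) (succᵇ u v w) ⟩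
      𝟙 (adj G u v ∧ (adj G v w ∧ not (does (u ≟ w))))  ≡⟨ cong 𝟙 reverse ⟩
      𝟙 (adj G w v ∧ (adj G v u ∧ not (does (w ≟ u))))  ≡⟨ 𝟙*𝟙 (adj G w v) (succᵇ w v u) ⟨
      a w v * s w v u                              ∎
      where
      open ≡-Reasoning
      ≟-sym : does (u ≟ w) ≡ does (w ≟ u)
      ≟-sym with u ≟ w | w ≟ u
      ... | yes _   | yes _   = refl
      ... | no _    | no _    = refl
      ... | yes u≡w | no w≢u  = ⊥-elim (w≢u (sym u≡w))
      ... | no u≢w  | yes w≡u = ⊥-elim (u≢w (sym w≡u))
      reverse : adj G u v ∧ (adj G v w ∧ not (does (u ≟ w))) ≡ adj G w v ∧ (adj G v u ∧ not (does (w ≟ u)))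
      reverse rewrite symm G u v | symm G v w | ≟-sym
        with adj G w v | adj G v u
      ... | true  | true  = refl
      ... | true  | false = refl
      ... | false | true  = refl
      ... | false | false = refl

  module Growth {n : ℕ} (G : Graph n) (t : ℚ) (1≤t : 1ℚ ≤ t) where
    open Counting G
    open LogBound t 1≤t

    X r : Fin n → ℚ
    X v = degree v - 1ℚ
    r v = recip (X v)

    μ : ℚ
    μ = recip t

    -- The value of `φ` at (degree - 1) / t with its denominator simplified to the degree. In this
    -- form the product with `degree v` is visibly affine in the degree, and an isolated vertex
    -- contributes 0.
    ψ : Fin n → ℚ
    ψ v = (t + 1ℚ) * (μ * X v - 1ℚ) * recip (degree v)

    tμ≡1 : t * μ ≡ 1ℚ
    tμ≡1 = *-recipʳ-pos (<-≤-trans 0<1 1≤t)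

    t*μX : ∀ v → t * (μ * X v) ≡ X v
    t*μX v = trans (sym (*-assoc t μ (X v))) (trans (cong (_* X v) tμ≡1) (*-identityˡ (X v)))

    ψ≡φ : ∀ v → ψ v ≡ φ (μ * X v)
    ψ≡φ v = cong (λ d → (t + 1ℚ) * (μ * X v - 1ℚ) * recip d)
      (trans (solve 1 (λ d → d := d :- con 1ℚ :+ con 1ℚ) refl (degree v)) (cong (_+ 1ℚ) (sym (t*μX v))))

    -- The expected sum of ψ along the random non-backtracking walk of length k from uv.
    potential : ℕ → Fin n → Fin n → ℚ
    potential zero    u v = 0ℚ
    potential (suc k) u v = ψ v + r v * sum λ w → s u v w * potential k v w

    module _ (2≤degree : ∀ {u v} → u ~ v → 2ℚ ≤ degree v) where

      1≤X : ∀ {u v} → u ~ v → 1ℚ ≤ X v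
      1≤X u~v = +-monoˡ-≤ (- 1ℚ) (2≤degree u~v)

      X*r : ∀ {u v} → u ~ v → X v * r v ≡ 1ℚ
      X*r u~v = *-recipʳ-pos (<-≤-trans 0<1 (1≤X u~v))

      -- A walk taken by the random non-backtracking walk with probability p contributes p times the
      -- product of `X` over the vertices at which it chose a continuation. So the count is t ^ k
      -- times an expected product of factors X / t. The list `c` stores the factors of the vertices
      -- already passed, which lets `1+sumOf-φ≤product` be applied to the complete product once the
      -- walk stops.
      walks-lower : ∀ k c → All Admissible c → ∀ {u v} → u ~ v →
        t ^ k * (1ℚ + sumOf φ c + potential k u v) ≤ product c * walks k u v
      walks-lower zero c adm u~v = begin
        1ℚ * (1ℚ + sumOf φ c + 0ℚ) ≡⟨ trans (*-identityˡ _) (+-identityʳ _) ⟩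
        1ℚ + sumOf φ c             ≤⟨ 1+sumOf-φ≤product c adm ⟩
        product c                  ≡⟨ *-identityʳ (product c) ⟨
        product c * 1ℚ             ∎
        where open ≤-Reasoning
      walks-lower (suc k) c adm {u} {v} u~v = begin
        t * t ^ k * (1ℚ + S + (ψ v + r v * Σsg))
          ≡⟨ solve 6 (λ t p S f r g → t :* p :* (con 1ℚ :+ S :+ (f :+ r :* g))
               := t :* p :* (con 1ℚ :* (con 1ℚ :+ S :+ f) :+ r :* g)) refl t (t ^ k) S (ψ v) (r v) Σsg ⟩
        t * t ^ k * (1ℚ * (1ℚ + S + ψ v) + r v * Σsg)
          -- There are `X v` continuations, so writing 1 as `X v * r v` spreads the constant part
          -- evenly over them.
          ≡⟨ cong (λ x → t * t ^ k * (x * (1ℚ + S + ψ v) + r v * Σsg)) (X*r u~v) ⟨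
        t * t ^ k * (X v * r v * (1ℚ + S + ψ v) + r v * Σsg)
          ≡⟨ solve 7 (λ t p S f r g x → t :* p :* (x :* r :* (con 1ℚ :+ S :+ f) :+ r :* g)
               := t :* r :* (p :* (con 1ℚ :+ (f :+ S)) :* x :+ p :* g)) refl t (t ^ k) S (ψ v) (r v) Σsg (X v) ⟩
        t * r v * (t ^ k * (1ℚ + (ψ v + S)) * X v + t ^ k * Σsg)
          ≡⟨ cong (t * r v *_) average ⟨
        t * r v * sum (λ w → s u v w * (t ^ k * (1ℚ + (ψ v + S) + potential k v w)))
          ≤⟨ *-monoˡ-≤ (t * r v) (0≤p*q 0≤t (0≤recip (≤-trans 0≤1 (1≤X u~v)))) (sum-mono step) ⟩
        t * r v * sum (λ w → s u v w * (μ * X v * Πc * walks k v w))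
          ≡⟨ cong (t * r v *_) (sum-* (μ * X v * Πc) λ w → swap (s u v w) (μ * X v * Πc) (walks k v w)) ⟩
        t * r v * (μ * X v * Πc * ΣsW)
          ≡⟨ solve 6 (λ t r m x p w → t :* r :* (m :* x :* p :* w) := t :* m :* (x :* r) :* (p :* w))
               refl t (r v) μ (X v) Πc ΣsW ⟩
        t * μ * (X v * r v) * (Πc * ΣsW)
          ≡⟨ cong₂ (λ x y → x * y * (Πc * ΣsW)) tμ≡1 (X*r u~v) ⟩
        1ℚ * 1ℚ * (Πc * ΣsW)
          ≡⟨ *-identityˡ (Πc * ΣsW) ⟩
        Πc * ΣsW ∎
        where
        open ≤-Reasoning
        S Πc Σsg ΣsW : ℚ
        S = sumOf φ c
        Πc = product c
        Σsg = sum λ w → s u v w * potential k v w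
        ΣsW = sum λ w → s u v w * walks k v w
        swap : ∀ x y z → x * (y * z) ≡ y * (x * z)
        swap = solve 3 (λ x y z → x :* (y :* z) := y :* (x :* z)) refl
        average : sum (λ w → s u v w * (t ^ k * (1ℚ + (ψ v + S) + potential k v w)))
          ≡ t ^ k * (1ℚ + (ψ v + S)) * X v + t ^ k * Σsg
        average = trans
          (sum-+ λ w → solve 4 (λ s p q g → s :* (p :* (q :+ g)) := p :* q :* s :+ p :* (s :* g)) refl
            (s u v w) (t ^ k) (1ℚ + (ψ v + S)) (potential k v w))
          (cong₂ _+_
            (trans (sum-* (t ^ k * (1ℚ + (ψ v + S))) λ w → refl) (cong (t ^ k * (1ℚ + (ψ v + S)) *_) (sum-s u~v)))
            (sum-* (t ^ k) λ w → refl))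
        step : ∀ w → s u v w * (t ^ k * (1ℚ + (ψ v + S) + potential k v w)) ≤ s u v w * (μ * X v * Πc * walks k v w)
        step w = 𝟙*-mono (succᵇ u v w) λ uvw →
          subst (λ x → t ^ k * (1ℚ + (x + S) + potential k v w) ≤ μ * X v * Πc * walks k v w) (sym (ψ≡φ v))
            -- The new factor is admissible because t times it is `X v`, which is at least 1 by
            -- minimum degree two.
            (walks-lower k (μ * X v ∷ c) (subst (1ℚ ≤_) (sym (t*μX v)) (1≤X u~v) ∷ adm) (succᵇ⇒~ u v w uvw))

      -- The uniform distribution on directed edges is stationary for the
      -- non-backtracking walk.
      stationary : (h : Fin n → Fin n → ℚ) → ∑∑ (λ u v → a u v * (r v * sum λ w → s u v w * h v w)) ≡ ∑∑ (λ v w → a v w * h v w)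
      stationary h = begin
        ∑∑ (λ u v → a u v * (r v * sum λ w → s u v w * h v w))
          ≡⟨ ∑∑-cong (λ u v → trans (sym (*-assoc (a u v) (r v) (sum λ w → s u v w * h v w)))
               (sym (sum-* (a u v * r v) λ w → refl))) ⟩
        ∑∑ (λ u v → sum λ w → a u v * r v * (s u v w * h v w))
          ≡⟨ sum-swap (λ u v → sum λ w → a u v * r v * (s u v w * h v w)) ⟩
        sum (λ v → sum λ u → sum λ w → a u v * r v * (s u v w * h v w))
          ≡⟨ sum-cong (λ v → sum-swap (λ u w → a u v * r v * (s u v w * h v w))) ⟩
        ∑∑ (λ v w → sum λ u → a u v * r v * (s u v w * h v w))
          ≡⟨ ∑∑-cong incoming ⟩
        ∑∑ (λ v w → a v w * h v w) ∎
        where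
        open ≡-Reasoning
        -- By reversal the edge vw has `X v` predecessors, each passing to it with the same
        -- probability `r v`, and these cancel.
        incoming : ∀ v w → sum (λ u → a u v * r v * (s u v w * h v w)) ≡ a v w * h v w
        incoming v w = begin
          sum (λ u → a u v * r v * (s u v w * h v w))
            ≡⟨ sum-cong (λ u → trans
                 (solve 4 (λ a r s h → a :* r :* (s :* h) := r :* h :* (a :* s)) refl (a u v) (r v) (s u v w) (h v w))
                 (cong (r v * h v w *_) (a*s-reverse u v w))) ⟩
          sum (λ u → r v * h v w * (a w v * s w v u))
            ≡⟨ sum-* (r v * h v w) (λ u → refl) ⟩
          r v * h v w * sum (λ u → a w v * s w v u)
            ≡⟨ cong (r v * h v w *_) (sum-* (a w v) (λ u → refl)) ⟩
          r v * h v w * (a w v * sum (s w v))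
            ≡⟨ cong (r v * h v w *_) (𝟙*-cong (adj G w v) sum-s) ⟩
          r v * h v w * (a w v * X v)
            ≡⟨ solve 4 (λ r h a x → r :* h :* (a :* x) := a :* (x :* r :* h)) refl (r v) (h v w) (a w v) (X v) ⟩
          a w v * (X v * r v * h v w)
            ≡⟨ 𝟙*-cong (adj G w v) (λ w~v → trans (cong (_* h v w) (X*r w~v)) (*-identityˡ (h v w))) ⟩
          a w v * h v w
            ≡⟨ cong (λ b → 𝟙 b * h v w) (symm G w v) ⟩
          a v w * h v w ∎

      module _ (mean : degreeSum ≡ (t + 1ℚ) * support) where

        -- Each v is counted `degree v` times, and `degree v * ψ v` is affine in the degree on the
        -- support. The total is (t + 1) * (μ * degreeSum - (μ + 1) * support), which vanishes
        -- because μ * (t + 1) = μ + 1.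
        ∑∑aψ≡0 : ∑∑ (λ u v → a u v * ψ v) ≡ 0ℚ
        ∑∑aψ≡0 = begin
          ∑∑ (λ u v → a u v * ψ v)
            ≡⟨ sum-swap (λ u v → a u v * ψ v) ⟩
          sum (λ v → sum λ u → a u v * ψ v)
            ≡⟨ sum-cong (λ v → sum-* (ψ v) λ u → trans (*-comm (a u v) (ψ v)) (cong (λ b → ψ v * 𝟙 b) (symm G u v))) ⟩
          sum (λ v → ψ v * degree v)
            ≡⟨ sum-cong (λ v → begin
                 ψ v * degree v
                   ≡⟨ solve 4 (λ t m d e → (t :+ con 1ℚ) :* (m :* (d :- con 1ℚ) :- con 1ℚ) :* e :* d
                        := (t :+ con 1ℚ) :* m :* (d :* (d :* e)) :+ :- ((t :+ con 1ℚ) :* (m :+ con 1ℚ)) :* (d :* e))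
                        refl t μ (degree v) (recip (degree v)) ⟩
                 (t + 1ℚ) * μ * (degree v * (degree v * recip (degree v))) + - ((t + 1ℚ) * (μ + 1ℚ)) * (degree v * recip (degree v))
                   ≡⟨ cong (λ x → (t + 1ℚ) * μ * x + - ((t + 1ℚ) * (μ + 1ℚ)) * (degree v * recip (degree v))) (d*d*recip (degree v)) ⟩
                 (t + 1ℚ) * μ * degree v + - ((t + 1ℚ) * (μ + 1ℚ)) * (degree v * recip (degree v)) ∎) ⟩
          sum (λ v → (t + 1ℚ) * μ * degree v + - ((t + 1ℚ) * (μ + 1ℚ)) * (degree v * recip (degree v)))
            ≡⟨ sum-+ (λ v → refl) ⟩
          sum (λ v → (t + 1ℚ) * μ * degree v) + sum (λ v → - ((t + 1ℚ) * (μ + 1ℚ)) * (degree v * recip (degree v)))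
            ≡⟨ cong₂ _+_ (sum-* ((t + 1ℚ) * μ) λ v → refl) (sum-* (- ((t + 1ℚ) * (μ + 1ℚ))) λ v → refl) ⟩
          (t + 1ℚ) * μ * degreeSum + - ((t + 1ℚ) * (μ + 1ℚ)) * support
            ≡⟨ cong (λ x → (t + 1ℚ) * μ * x + - ((t + 1ℚ) * (μ + 1ℚ)) * support) mean ⟩
          (t + 1ℚ) * μ * ((t + 1ℚ) * support) + - ((t + 1ℚ) * (μ + 1ℚ)) * support
            ≡⟨ solve 3 (λ t m N → (t :+ con 1ℚ) :* m :* ((t :+ con 1ℚ) :* N) :+ :- ((t :+ con 1ℚ) :* (m :+ con 1ℚ)) :* N
                 := (t :+ con 1ℚ) :* N :* (t :* m :- con 1ℚ)) refl t μ support ⟩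
          (t + 1ℚ) * support * (t * μ - 1ℚ)
            ≡⟨ cong (λ x → (t + 1ℚ) * support * (x - 1ℚ)) tμ≡1 ⟩
          (t + 1ℚ) * support * 0ℚ
            ≡⟨ *-zeroʳ ((t + 1ℚ) * support) ⟩
          0ℚ ∎
          where
          open ≡-Reasoning
          d*d*recip : ∀ d → d * (d * recip d) ≡ d
          d*d*recip d with d Data.Rational.≟ 0ℚ
          ... | yes refl = refl
          ... | no d≢0   = trans (cong (d *_) (*-inverseʳ d {{≢-nonZero d≢0}})) (*-identityʳ d)

        -- By stationarity the edge reached after any number of steps is again uniform, so every
        -- step contributes the average `∑∑aψ≡0`.
        ∑∑a*potential≡0 : ∀ k → ∑∑ (λ u v → a u v * potential k u v) ≡ 0ℚ
        ∑∑a*potential≡0 zero = sum-0 λ u → sum-0 λ v → *-zeroʳ (a u v)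
        ∑∑a*potential≡0 (suc k) = trans
          (trans (∑∑-cong λ u v → *-distribˡ-+ (a u v) (ψ v) (r v * sum λ w → s u v w * potential k v w)) (∑∑-+ (λ u v → a u v * ψ v) (λ u v → a u v * (r v * sum λ w → s u v w * potential k v w))))
          (trans (cong₂ _+_ ∑∑aψ≡0 (trans (stationary (potential k)) (∑∑a*potential≡0 k))) (+-identityʳ 0ℚ))

        degreeSum*t^k≤walks : ∀ k → degreeSum * t ^ k ≤ ∑∑ (λ u v → a u v * walks k u v)
        degreeSum*t^k≤walks k = begin
          degreeSum * t ^ k
            ≡⟨ solve 2 (λ d p → d :* p := p :* d :+ p :* con 0ℚ) refl degreeSum (t ^ k) ⟩
          t ^ k * degreeSum + t ^ k * 0ℚ
            ≡⟨ cong (λ x → t ^ k * degreeSum + t ^ k * x) (∑∑a*potential≡0 k) ⟨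
          t ^ k * degreeSum + t ^ k * ∑∑ (λ u v → a u v * potential k u v)
            ≡⟨ cong₂ _+_ (∑∑-* (t ^ k) a) (∑∑-* (t ^ k) (λ u v → a u v * potential k u v)) ⟨
          ∑∑ (λ u v → t ^ k * a u v) + ∑∑ (λ u v → t ^ k * (a u v * potential k u v))
            ≡⟨ ∑∑-+ (λ u v → t ^ k * a u v) (λ u v → t ^ k * (a u v * potential k u v)) ⟨
          ∑∑ (λ u v → t ^ k * a u v + t ^ k * (a u v * potential k u v))
            ≡⟨ ∑∑-cong (λ u v → solve 3 (λ p a g → p :* a :+ p :* (a :* g) := a :* (p :* (con 1ℚ :+ con 0ℚ :+ g)))
                 refl (t ^ k) (a u v) (potential k u v)) ⟩
          ∑∑ (λ u v → a u v * (t ^ k * (1ℚ + 0ℚ + potential k u v)))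
            ≤⟨ ∑∑-mono (λ u v → 𝟙*-mono (adj G u v) λ u~v →
                 ≤-trans (walks-lower k [] [] u~v) (≤-reflexive (*-identityˡ (walks k u v)))) ⟩
          ∑∑ (λ u v → a u v * walks k u v) ∎
          where open ≤-Reasoning

        degreeSum*geometric≤shortWalks : ∀ k → degreeSum * geometric t k ≤ ∑∑ (λ u v → a u v * shortWalks k u v)
        degreeSum*geometric≤shortWalks zero = degreeSum*t^k≤walks 0
        degreeSum*geometric≤shortWalks (suc k) = begin
          degreeSum * (t ^ suc k + geometric t k)
            ≡⟨ *-distribˡ-+ degreeSum (t ^ suc k) (geometric t k) ⟩
          degreeSum * t ^ suc k + degreeSum * geometric t k
            ≤⟨ +-mono-≤ (degreeSum*t^k≤walks (suc k)) (degreeSum*geometric≤shortWalks k) ⟩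
          ∑∑ (λ u v → a u v * walks (suc k) u v) + ∑∑ (λ u v → a u v * shortWalks k u v)
            ≡⟨ ∑∑-+ (λ u v → a u v * walks (suc k) u v) (λ u v → a u v * shortWalks k u v) ⟨
          ∑∑ (λ u v → a u v * walks (suc k) u v + a u v * shortWalks k u v)
            ≡⟨ ∑∑-cong (λ u v → trans (cong (a u v *_) (shortWalks-suc k u v)) (*-distribˡ-+ (a u v) (walks (suc k) u v) (shortWalks k u v))) ⟨
          ∑∑ (λ u v → a u v * shortWalks (suc k) u v) ∎
          where open ≤-Reasoning

        -- Reversal permutes the directed edges, so both terms of `few` have the same total over
        -- them; the factor `degreeSum`, the number of directed edges, then cancels.
        moore : ∀ k → 0ℚ < degreeSum → (∀ {u v} → u ~ v → shortWalks k u v + shortWalks k v u ≤ ι n) →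
          2ℚ * geometric t k ≤ ι n
        moore k 0<D few = *-cancelˡ-≤-pos degreeSum {{positive 0<D}} (begin
          degreeSum * (2ℚ * geometric t k)
            ≡⟨ solve 2 (λ d g → d :* (con 2ℚ :* g) := d :* g :+ d :* g) refl degreeSum (geometric t k) ⟩
          degreeSum * geometric t k + degreeSum * geometric t k
            ≤⟨ +-mono-≤ (degreeSum*geometric≤shortWalks k) (degreeSum*geometric≤shortWalks k) ⟩
          ∑∑ (λ u v → a u v * shortWalks k u v) + ∑∑ (λ u v → a u v * shortWalks k u v)
            ≡⟨ cong (∑∑ (λ u v → a u v * shortWalks k u v) +_) (trans (sum-swap (λ u v → a u v * shortWalks k u v))
                 (∑∑-cong λ u v → cong (λ b → 𝟙 b * shortWalks k v u) (symm G v u))) ⟩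
          ∑∑ (λ u v → a u v * shortWalks k u v) + ∑∑ (λ u v → a u v * shortWalks k v u)
            ≡⟨ ∑∑-+ (λ u v → a u v * shortWalks k u v) (λ u v → a u v * shortWalks k v u) ⟨
          ∑∑ (λ u v → a u v * shortWalks k u v + a u v * shortWalks k v u)
            ≡⟨ ∑∑-cong (λ u v → *-distribˡ-+ (a u v) (shortWalks k u v) (shortWalks k v u)) ⟨
          ∑∑ (λ u v → a u v * (shortWalks k u v + shortWalks k v u))
            ≤⟨ ∑∑-mono (λ u v → 𝟙*-mono (adj G u v) few) ⟩
          ∑∑ (λ u v → a u v * ι n)
            ≡⟨ ∑∑-cong (λ u v → *-comm (a u v) (ι n)) ⟩
          ∑∑ (λ u v → ι n * a u v)
            ≡⟨ ∑∑-* (ι n) a ⟩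
          ι n * degreeSum
            ≡⟨ *-comm (ι n) degreeSum ⟩
          degreeSum * ι n ∎)
          where open ≤-Reasoning

-- Closed non-backtracking walks contain cycles.

module ShortCycles where
  open import Data.Bool using (Bool; true; false; T; not; _∨_)
  open import Data.Bool.Properties using (T-∨; ¬-not; not-involutive)
  open import Data.Empty using (⊥; ⊥-elim)
  open import Data.Fin using (Fin; toℕ)
  open import Data.Fin.Properties using (any?; toℕ<n; toℕ-injective) renaming (_≟_ to _≟ᶠ_)
  open import Data.List.Membership.Propositional.Properties using (∈-upTo⁺)
  open import Data.List.Relation.Unary.All as All using ()
  open import Data.List.Relation.Unary.All.Properties using (map⁻)
  open import Data.Nat
  open import Data.Nat.DivMod using (m<n⇒m%n≡m; n%n≡0)
  open import Data.Nat.Induction using (<-rec)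
  open import Data.Nat.Properties
  open import Data.Product using (∃; _×_; _,_; proj₁; proj₂)
  open import Data.Sum using (_⊎_; inj₁; inj₂)
  open import Function using (Equivalence)
  open import Function.Definitions using (Injective)
  open import Relation.Binary.Definitions using (tri<; tri≈; tri>)
  open import Relation.Binary.PropositionalEquality
    using (_≡_; _≢_; refl; sym; trans; cong; subst)
  open import Relation.Nullary using (yes; no)
  open import Relation.Nullary.Decidable using (_×-dec_)
  open import Defs using (Graph; irrefl; Bipartite; Free; 𝓒; cycle; next; IsCopy)

  module _ {n : ℕ} (G : Graph n) where
    open NonBacktrackingWalks.Counting G using (_~_; ~-sym)

    -- NB u v x k: non-backtracking walks u, v, … , x with k + 1 edges.
    data NB : Fin n → Fin n → Fin n → ℕ → Set where
      stop : ∀ {u v} → u ~ v → NB u v v 0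
      step : ∀ {u v w x k} → u ~ v → u ≢ w → NB v w x k → NB u v x (suc k)

    first : ∀ {u v x k} → NB u v x k → u ~ v
    first (stop u~v)     = u~v
    first (step u~v _ _) = u~v

    -- The two walks start with the same edge in opposite directions, so the reverse of the first
    -- overlaps the second in that edge and the union does not backtrack. The recursion moves edges
    -- one by one from the front of the first walk to the front of the second.
    glue : ∀ {u v x y k l} → NB u v x k → NB v u y l → ∃ λ q → NB x q y (k + l)
    glue {u} (stop _) r = u , r
    glue {y = y} {l = l} (step {x = x} {k} u~v u≢w p) r =
      let q , c = glue p (step (~-sym (first p)) (λ w≡u → u≢w (sym w≡u)) r)
      in q , subst (NB x q y) (+-suc k l) c

    -- Total in the position: beyond the end the last vertex is repeated, so bounds on positions
    -- appear only where adjacency is claimed.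
    vertex : ∀ {u v x k} → NB u v x k → ℕ → Fin n
    vertex {u} _            zero    = u
    vertex {v = v} (stop _) (suc _) = v
    vertex (step _ _ p)     (suc i) = vertex p i

    vertex-~ : ∀ {u v x k} (p : NB u v x k) i → i ≤ k → vertex p i ~ vertex p (suc i)
    vertex-~ (stop u~v)            zero    _         = u~v
    vertex-~ (step u~v _ (stop _)) zero    _         = u~v
    vertex-~ (step u~v _ (step _ _ _)) zero _        = u~v
    vertex-~ (step _ _ p)          (suc i) (s≤s i≤k) = vertex-~ p i i≤k

    vertex-1 : ∀ {u v x k} (p : NB u v x k) → vertex p 1 ≡ v
    vertex-1 (stop _)              = refl
    vertex-1 (step _ _ (stop _))   = refl
    vertex-1 (step _ _ (step _ _ _)) = refl

    vertex-≢ : ∀ {u v x k} (p : NB u v x k) i → i < k → vertex p i ≢ vertex p (suc (suc i))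
    vertex-≢ (step _ u≢w p) zero    _         eq = u≢w (trans eq (vertex-1 p))
    vertex-≢ (step _ _ p)   (suc i) (s≤s i<k) = vertex-≢ p i i<k

    vertex-last : ∀ {u v x k} (p : NB u v x k) → vertex p (suc k) ≡ x
    vertex-last (stop _)     = refl
    vertex-last (step _ _ p) = vertex-last p

    module _ {ℓ : ℕ} (bipartite : Bipartite G) (free : Free (𝓒 ℓ) G) where

      module _ {u v : Fin n} {k : ℕ} (p : NB u v u k) (k≤2ℓ : k ≤ 2 * ℓ) where

        colour : ℕ → Bool
        colour i = proj₁ bipartite (vertex p i)

        colour-suc : ∀ {i} → i ≤ k → colour (suc i) ≡ not (colour i)
        colour-suc {i} i≤k = ¬-not λ eq → proj₂ bipartite _ _ (vertex-~ p i i≤k) (sym eq)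

        colour-even : ∀ m i → m + m + i ≤ suc k → colour (m + m + i) ≡ colour i
        colour-even zero    i _ = refl
        colour-even (suc m) i le rewrite +-suc m m = trans
          (colour-suc (s≤s⁻¹ le))
          (trans (cong not (colour-suc (≤-trans (n≤1+n _) (s≤s⁻¹ le))))
            (trans (not-involutive _) (colour-even m i (≤-trans (n≤1+n _) (≤-trans (n≤1+n _) le)))))

        -- A stretch of `d` edges inside the walk that returns to its starting position `i`.
        Closed : ℕ → Set
        Closed d = ∃ λ i → 1 ≤ d × d + i ≤ suc k × vertex p (d + i) ≡ vertex p i

        module _ {d : ℕ} (3≤d : 3 ≤ d) (i : ℕ) (d+i≤ : d + i ≤ suc k) (closes : vertex p (d + i) ≡ vertex p i)
          (distinct : ∀ {a b : Fin d} → toℕ a < toℕ b → vertex p (toℕ a + i) ≢ vertex p (toℕ b + i)) where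

          around : Fin d → Fin n
          around a = vertex p (toℕ a + i)

          around-injective : Injective _≡_ _≡_ around
          around-injective {a} {b} eq with <-cmp (toℕ a) (toℕ b)
          ... | tri< a<b _ _ = ⊥-elim (distinct a<b eq)
          ... | tri≈ _ a≡b _ = toℕ-injective a≡b
          ... | tri> _ _ b<a = ⊥-elim (distinct b<a (sym eq))

          -- `next` reduces only for a successor, and the fixed parameter `d` cannot be split; hence
          -- the size is generalised to `d′`. The edge that wraps around is supplied by `closes`.
          around-next : ∀ {d′} → d′ ≡ d → (a b : Fin d′) → T (next a b) → vertex p (toℕ a + i) ~ vertex p (toℕ b + i)
          around-next {suc d′} refl a b t with m≤n⇒m<n∨m≡n (toℕ<n a)
          ... | inj₁ 1+a<d = subst (λ j → vertex p (toℕ a + i) ~ vertex p (j + i))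
            (trans (sym (m<n⇒m%n≡m 1+a<d)) (≡ᵇ⇒≡ _ _ t))
            (vertex-~ p _ (≤-trans (+-monoˡ-≤ i (s≤s⁻¹ (≤-trans (n≤1+n _) 1+a<d))) (s≤s⁻¹ d+i≤)))
          ... | inj₂ 1+a≡d = subst (vertex p (toℕ a + i) ~_)
            (trans (cong (λ j → vertex p (j + i)) 1+a≡d) (trans closes
              (cong (λ j → vertex p (j + i)) (trans (sym (n%n≡0 (suc d′)))
                (trans (sym (cong (_% suc d′) 1+a≡d)) (≡ᵇ⇒≡ _ _ t))))))
            (vertex-~ p _ (≤-trans (+-monoˡ-≤ i (s≤s⁻¹ (≤-reflexive 1+a≡d))) (s≤s⁻¹ d+i≤)))

          around-copy : IsCopy (cycle d 3≤d) G around
          around-copy = around-injective , λ a b t → adjacent a b (Equivalence.to T-∨ t)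
            where
            adjacent : ∀ a b → T (next a b) ⊎ T (next b a) → around a ~ around b
            adjacent a b (inj₁ ab) = around-next refl a b ab
            adjacent a b (inj₂ ba) = ~-sym (around-next refl b a ba)

        -- The walk may have up to 2ℓ + 1 edges, one more than the longest forbidden cycle; evenness
        -- of `d` recovers m ≤ ℓ. The cases m = 0 and m = 1 fall to `3≤d`.
        cycle-absurd : ∀ {d} → (3≤d : 3 ≤ d) → d ≤ suc k → ∀ m → d ≡ 2 * m →
          (f : Fin d → Fin n) → IsCopy (cycle d 3≤d) G f → ⊥
        cycle-absurd () _ 0 refl
        cycle-absurd (s≤s (s≤s ())) _ 1 refl
        cycle-absurd 3≤d d≤ (suc (suc m)) refl f copy =
          All.lookup (map⁻ free) (∈-upTo⁺ (∸-monoˡ-≤ 1 m+2≤ℓ)) (f , copy)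
          where
          m+2≤ℓ : suc (suc m) ≤ ℓ
          m+2≤ℓ = s≤s⁻¹ (*-cancelˡ-< 2 (suc (suc m)) (suc ℓ) (≤-trans (s≤s d≤)
            (≤-trans (s≤s (s≤s k≤2ℓ)) (≤-reflexive (sym (*-suc 2 ℓ))))))

        halve : ∀ d → ∃ λ m → d ≡ m + m ⊎ d ≡ suc (m + m)
        halve zero = 0 , inj₁ refl
        halve (suc d) with halve d
        ... | m , inj₁ refl = m , inj₂ refl
        ... | m , inj₂ refl = suc m , inj₁ (cong suc (sym (+-suc m m)))

        -- Strong induction on the length of the stretch. Length 1 would be a loop and length 2 a
        -- backtrack. A repeated vertex inside gives a shorter closed stretch. Without one the
        -- stretch is a cycle, which is forbidden if even and contradicts the colouring if odd.
        not-Closed : ∀ d → Closed d → ⊥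
        not-Closed = <-rec _ λ d rec (i , 1≤d , d+i≤ , closes) → go d rec i 1≤d d+i≤ closes
          where
          go : ∀ d → (∀ {d′} → d′ < d → Closed d′ → ⊥) → ∀ i → 1 ≤ d → d + i ≤ suc k →
            vertex p (d + i) ≡ vertex p i → ⊥
          go 1 rec i _ (s≤s i≤k) closes =
            subst T (irrefl G (vertex p i)) (subst (vertex p i ~_) closes (vertex-~ p i i≤k))
          go 2 rec i _ (s≤s i<k) closes = vertex-≢ p i i<k (sym closes)
          go d@(suc (suc (suc _))) rec i _ d+i≤ closes
            with any? (λ (a : Fin d) → any? λ (b : Fin d) → (toℕ a <? toℕ b) ×-dec (vertex p (toℕ a + i) ≟ᶠ vertex p (toℕ b + i)))
          ... | yes (a , b , a<b , eq) = rec (≤-<-trans (m∸n≤m (toℕ b) (toℕ a)) (toℕ<n b))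
            (toℕ a + i , m<n⇒0<n∸m a<b ,
             subst (_≤ suc k) (sym b-a) (≤-trans (+-monoˡ-≤ i (<⇒≤ (toℕ<n b))) d+i≤) ,
             trans (cong (vertex p) b-a) (sym eq))
            where
            b-a : toℕ b ∸ toℕ a + (toℕ a + i) ≡ toℕ b + i
            b-a = trans (sym (+-assoc (toℕ b ∸ toℕ a) (toℕ a) i)) (cong (_+ i) (m∸n+n≡m (<⇒≤ a<b)))
          ... | no ¬chord with halve d
          ...   | m , inj₁ even = cycle-absurd 3≤d (≤-trans (m≤m+n d i) d+i≤) m
            (trans even (cong (m +_) (sym (+-identityʳ m)))) _
            (around-copy 3≤d i d+i≤ closes λ {a} {b} a<b eq → ¬chord (a , b , a<b , eq))
            where
            3≤d : 3 ≤ d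
            3≤d = s≤s (s≤s (s≤s z≤n))
          ...   | m , inj₂ odd = no-fixpoint (trans (sym flipped) (cong (proj₁ bipartite) closes))
            where
            d+i≤′ : suc (m + m) + i ≤ suc k
            d+i≤′ = subst (λ e → e + i ≤ suc k) odd d+i≤
            flipped : colour (d + i) ≡ not (colour i)
            flipped = trans (cong (λ e → colour (e + i)) odd)
              (trans (colour-suc (s≤s⁻¹ d+i≤′)) (cong not (colour-even m i (≤-trans (n≤1+n _) d+i≤′))))
            no-fixpoint : ∀ {b} → not b ≡ b → ⊥
            no-fixpoint {true}  ()
            no-fixpoint {false} ()

        no-closed-walk : ⊥
        no-closed-walk = not-Closed (suc k) (0 , s≤s z≤n , ≤-reflexive (+-identityʳ (suc k)) ,
          trans (cong (vertex p) (+-identityʳ (suc k))) (vertex-last p))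

-- Each vertex ends at most one short walk from an edge.

module Endpoints where
  open import Data.Bool using (Bool; true; false; T; not)
  open import Data.Bool.Properties using (T-∧)
  open import Data.Empty using (⊥; ⊥-elim)
  open import Data.Fin using (Fin; zero; suc; _≟_)
  open import Data.Fin.Properties using (suc-injective; 0≢1+n)
  open import Data.Nat as ℕ using (ℕ; zero; suc; z≤n; s≤s)
  import Data.Nat.Properties as ℕₚ
  open import Data.Product using (∃; _×_; _,_; proj₁; proj₂)
  open import Data.Rational hiding (_≟_)
  open import Data.Rational.Properties hiding (_≟_)
  open import Data.Sum using (_⊎_; inj₁; inj₂)
  open import Function using (Equivalence)
  open import Relation.Binary.PropositionalEquality
    using (_≡_; _≢_; refl; sym; trans; cong; cong₂; subst; module ≡-Reasoning)
  open import Relation.Nullary using (¬_; does; yes; no)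
  open import Defs using (Graph; Bipartite; Free; 𝓒)
  open RationalInequalities
  open FiniteSums
  open NonBacktrackingWalks
  open ShortCycles

  -- A nonzero count carries a witness of what it counts. If the witnesses of several counts exclude
  -- each other, their sum is again 0 or 1, and no list of walks is ever formed.
  ZeroOrOne : ℚ → Set → Set
  ZeroOrOne p P = p ≡ 0ℚ ⊎ (p ≡ 1ℚ × P)

  zeroOrOne⇒≤1 : ∀ {p P} → ZeroOrOne p P → p ≤ 1ℚ
  zeroOrOne⇒≤1 (inj₁ refl)       = 0≤1
  zeroOrOne⇒≤1 (inj₂ (refl , _)) = ≤-refl

  zeroOrOne-map : ∀ {p P Q} → (P → Q) → ZeroOrOne p P → ZeroOrOne p Q
  zeroOrOne-map f (inj₁ p≡0)       = inj₁ p≡0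
  zeroOrOne-map f (inj₂ (p≡1 , x)) = inj₂ (p≡1 , f x)

  zeroOrOne-refute : ∀ {p P} → ZeroOrOne p P → ¬ P → p ≡ 0ℚ
  zeroOrOne-refute (inj₁ p≡0)     _  = p≡0
  zeroOrOne-refute (inj₂ (_ , x)) ¬P = ⊥-elim (¬P x)

  zeroOrOne-+ : ∀ {p q P Q} → ZeroOrOne p P → ZeroOrOne q Q → (P → Q → ⊥) → ZeroOrOne (p + q) (P ⊎ Q)
  zeroOrOne-+ {q = q} (inj₁ refl) zq _ =
    subst (λ x → ZeroOrOne x _) (sym (+-identityˡ q)) (zeroOrOne-map inj₂ zq)
  zeroOrOne-+ {p} (inj₂ (p≡1 , x)) zq disjoint =
    inj₂ (trans (cong₂ _+_ p≡1 (zeroOrOne-refute zq (disjoint x))) (+-identityʳ 1ℚ) , inj₁ x)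

  zeroOrOne-sum : ∀ {n} {f : Fin n → ℚ} {P : Fin n → Set} → (∀ i → ZeroOrOne (f i) (P i)) →
    (∀ {i j} → P i → P j → i ≡ j) → ZeroOrOne (sum f) (∃ P)
  zeroOrOne-sum {zero} zf unique = inj₁ (sum-0 λ ())
  zeroOrOne-sum {suc n} {f} zf unique = subst (λ x → ZeroOrOne x _) (sym (sum-suc f))
    (zeroOrOne-map (λ { (inj₁ x) → zero , x ; (inj₂ (i , x)) → suc i , x })
      (zeroOrOne-+ (zf zero)
        (zeroOrOne-sum (λ i → zf (suc i)) (λ x y → suc-injective (unique x y)))
        (λ x (i , y) → 0≢1+n (unique x y))))

  zeroOrOne-𝟙 : ∀ b → ZeroOrOne (𝟙 b) (T b)
  zeroOrOne-𝟙 true  = inj₂ (refl , _)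
  zeroOrOne-𝟙 false = inj₁ refl

  zeroOrOne-* : ∀ b {p P} → (T b → ZeroOrOne p P) → ZeroOrOne (𝟙 b * p) (T b × P)
  zeroOrOne-* true  {p} zp = subst (λ x → ZeroOrOne x _) (sym (*-identityˡ p)) (zeroOrOne-map (_ ,_) (zp _))
  zeroOrOne-* false {p} _  = inj₁ (*-zeroˡ p)

  T-does⇒≡ : ∀ {n} {i j : Fin n} → T (does (i ≟ j)) → i ≡ j
  T-does⇒≡ {i = i} {j} t with i ≟ j
  ... | yes i≡j = i≡j

  T-not-does⇒≢ : ∀ {n} {i j : Fin n} → T (not (does (i ≟ j))) → i ≢ j
  T-not-does⇒≢ {i = i} {j} t with i ≟ j
  ... | no i≢j = i≢j

  module _ {n : ℕ} (G : Graph n) where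
    open Counting G

    -- ending k u v x counts the walks of shortWalks k u v that end at x.
    ending : ℕ → Fin n → Fin n → Fin n → ℚ
    ending zero    u v x = δ v x
    ending (suc k) u v x = δ v x + sum λ w → s u v w * ending k v w x

    sum-ending : ∀ k u v → sum (ending k u v) ≡ shortWalks k u v
    sum-ending zero    u v = sum-δ v
    sum-ending (suc k) u v = begin
      sum (ending (suc k) u v)
        ≡⟨ sum-+ (λ x → refl) ⟩
      sum (δ v) + sum (λ x → sum λ w → s u v w * ending k v w x)
        ≡⟨ cong₂ _+_ (sum-δ v) (sum-swap λ x w → s u v w * ending k v w x) ⟩
      1ℚ + sum (λ w → sum λ x → s u v w * ending k v w x)
        ≡⟨ cong (1ℚ +_) (sum-cong λ w → trans (sum-* (s u v w) λ x → refl) (cong (s u v w *_) (sum-ending k v w))) ⟩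
      shortWalks (suc k) u v ∎
      where open ≡-Reasoning

    Reach : ℕ → Fin n → Fin n → Fin n → Set
    Reach k u v x = ∃ λ j → j ℕ.≤ k × NB G u v x j

    module _ {ℓ : ℕ} (bipartite : Bipartite G) (free : Free (𝓒 ℓ) G) where

      closed-absurd : ∀ {x q j} → NB G x q x j → j ℕ.≤ ℓ ℕ.+ ℓ → ⊥
      closed-absurd p j≤ = no-closed-walk G {ℓ = ℓ} bipartite free p
        (ℕₚ.≤-trans j≤ (ℕₚ.≤-reflexive (cong (ℓ ℕ.+_) (sym (ℕₚ.+-identityʳ ℓ)))))

      -- Two walks that leave v towards different w and w′ and meet in x are glued along w, v, w′ to
      -- a closed walk; a walk that stops at v and one that returns to v leave a closed walk from v.
      -- Both are short enough for `no-closed-walk`.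
      ending-zeroOrOne : ∀ k → k ℕ.≤ ℓ → ∀ {u v} → u ~ v → ∀ x → ZeroOrOne (ending k u v x) (Reach k u v x)
      ending-zeroOrOne zero _ {u} {v} u~v x = zeroOrOne-map reach (zeroOrOne-𝟙 (does (v ≟ x)))
        where
        reach : T (does (v ≟ x)) → Reach 0 u v x
        reach t = 0 , z≤n , subst (λ y → NB G u v y 0) (T-does⇒≡ t) (stop u~v)
      ending-zeroOrOne (suc k) k<ℓ {u} {v} u~v x = zeroOrOne-map reach
        (zeroOrOne-+ (zeroOrOne-𝟙 (does (v ≟ x)))
          (zeroOrOne-sum
            (λ w → zeroOrOne-* (succᵇ u v w) λ uvw → ending-zeroOrOne k (ℕₚ.<⇒≤ k<ℓ) (succᵇ⇒~ u v w uvw) x)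
            (λ {w} {w′} → unique w w′))
          not-back)
        where
        unique : ∀ w w′ → T (succᵇ u v w) × Reach k v w x → T (succᵇ u v w′) × Reach k v w′ x → w ≡ w′
        unique w w′ (uvw , j , j≤k , p) (_ , j′ , j′≤k , p′) with w ≟ w′
        ... | yes w≡w′ = w≡w′
        ... | no w≢w′ = ⊥-elim (closed-absurd
          (proj₂ (glue G p (step (~-sym (succᵇ⇒~ u v w uvw)) w≢w′ p′)))
          (ℕₚ.+-mono-≤ (ℕₚ.≤-trans j≤k (ℕₚ.<⇒≤ k<ℓ)) (ℕₚ.≤-trans (s≤s j′≤k) k<ℓ)))
        not-back : T (does (v ≟ x)) → ∃ (λ w → T (succᵇ u v w) × Reach k v w x) → ⊥
        not-back t (w , _ , j , j≤k , p) = closed-absurd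
          (subst (λ y → NB G v w y j) (sym (T-does⇒≡ t)) p)
          (ℕₚ.≤-trans j≤k (ℕₚ.≤-trans (ℕₚ.<⇒≤ k<ℓ) (ℕₚ.m≤m+n ℓ ℓ)))
        reach : T (does (v ≟ x)) ⊎ ∃ (λ w → T (succᵇ u v w) × Reach k v w x) → Reach (suc k) u v x
        reach (inj₁ t) = 0 , z≤n , subst (λ y → NB G u v y 0) (T-does⇒≡ t) (stop u~v)
        reach (inj₂ (w , uvw , j , j≤k , p)) =
          suc j , s≤s j≤k , step u~v (T-not-does⇒≢ (proj₂ (Equivalence.to T-∧ uvw))) p

      -- Walks from the two directions that meet in x share the edge uv and close up to at most 2ℓ +
      -- 1 edges, exactly the length that `no-closed-walk` still excludes.
      shortWalks-≤n : ∀ {u v} → u ~ v → shortWalks ℓ u v + shortWalks ℓ v u ≤ ι n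
      shortWalks-≤n {u} {v} u~v = begin
        shortWalks ℓ u v + shortWalks ℓ v u
          ≡⟨ cong₂ _+_ (sum-ending ℓ u v) (sum-ending ℓ v u) ⟨
        sum (ending ℓ u v) + sum (ending ℓ v u)
          ≡⟨ sum-+ (λ x → refl) ⟨
        sum (λ x → ending ℓ u v x + ending ℓ v u x)
          ≤⟨ sum-mono (λ x → zeroOrOne⇒≤1 (zeroOrOne-+
               (ending-zeroOrOne ℓ ℕₚ.≤-refl u~v x) (ending-zeroOrOne ℓ ℕₚ.≤-refl (~-sym u~v) x)
               λ (j , j≤ℓ , p) (j′ , j′≤ℓ , p′) → closed-absurd (proj₂ (glue G p p′)) (ℕₚ.+-mono-≤ j≤ℓ j′≤ℓ))) ⟩
        sum {n} (λ _ → 1ℚ)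
          ≡⟨ sum-1 n ⟩
        ι n ∎
        where open ≤-Reasoning

-- Edge counts as degree sums, and removal of vertices of degree one.

module Peeling where
  open import Data.Bool using (Bool; true; false; T; not; _∧_)
  open import Data.Bool.Properties using (T-∧; T?; ∧-comm; ∧-zeroʳ)
  open import Data.Empty using (⊥; ⊥-elim)
  open import Data.Fin using (Fin; zero; suc; _≟_)
  open import Data.Fin.Properties using (any?; <-asym)
  open import Data.List using (_++_; length; filter; map; tabulate; cartesianProduct; allFin)
  open import Data.List.Properties using (filter-++; length-++; map-tabulate)
  open import Data.List.Relation.Unary.All as All using ()
  open import Data.Nat as ℕ using (ℕ; zero; suc)
  open import Data.Product using (∃; _×_; _,_; proj₁; proj₂)
  open import Data.Rational hiding (_≟_)
  open import Data.Rational.Properties hiding (_≟_; <-asym)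
  open import Data.Rational.Solver using (module +-*-Solver)
  open import Data.Sum using (_⊎_; inj₁; inj₂)
  open import Function using (Equivalence; id)
  open import Relation.Binary.PropositionalEquality
    using (_≡_; _≢_; refl; sym; trans; cong; cong₂; subst; module ≡-Reasoning)
  open import Relation.Nullary using (¬_; Dec; does; yes; no)
  open import Relation.Unary using (Decidable)
  open import Defs using (Graph; adj; symm; irrefl; Bipartite; Free; ∣E_∣)
  open RationalInequalities
  open FiniteSums
  open NonBacktrackingWalks
  open Endpoints
  open Counting
  open +-*-Solver

  ι-+ : ∀ m n → ι (m ℕ.+ n) ≡ ι m + ι n
  ι-+ zero    n = sym (+-identityˡ (ι n))
  ι-+ (suc m) n = trans (cong (1ℚ +_) (ι-+ m n)) (sym (+-assoc 1ℚ (ι m) (ι n)))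

  0≤ι : ∀ n → 0ℚ ≤ ι n
  0≤ι zero    = ≤-refl
  0≤ι (suc n) = 0≤p+q 0≤1 (0≤ι n)

  𝟙-false : ∀ {b} → ¬ T b → 𝟙 b ≡ 0ℚ
  𝟙-false {true}  ¬t = ⊥-elim (¬t _)
  𝟙-false {false} _  = refl

  1≤𝟙 : ∀ {b} → T b → 1ℚ ≤ 𝟙 b
  1≤𝟙 {true} _ = ≤-refl

  sum-0≤ : ∀ {n} {f : Fin n → ℚ} → (∀ i → 0ℚ ≤ f i) → 0ℚ ≤ sum f
  sum-0≤ {f = f} 0≤f = ≤-trans (≤-reflexive (sym (sum-0 λ _ → refl))) (sum-mono {g = f} 0≤f)

  sum-δ-* : ∀ {n} (i : Fin n) (f : Fin n → ℚ) → sum (λ j → δ i j * f j) ≡ f i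
  sum-δ-* i f = begin
    sum (λ j → δ i j * f j)  ≡⟨ sum-* (f i) (λ j → trans (𝟙*-cong (does (i ≟ j)) λ t → cong f (sym (T-does⇒≡ t)))
                                                         (*-comm (δ i j) (f i))) ⟩
    f i * sum (δ i)          ≡⟨ cong (f i *_) (sum-δ i) ⟩
    f i * 1ℚ                 ≡⟨ *-identityʳ (f i) ⟩
    f i                      ∎
    where open ≡-Reasoning

  -- Stated for arbitrary `f` because the tail of a tabulated list is tabulated from a shifted
  -- function; `allFin` is the case of the identity.
  count-tabulate : ∀ {A : Set} {P : A → Set} (P? : Decidable P) {n} (f : Fin n → A) →
    ι (length (filter P? (tabulate f))) ≡ sum λ i → 𝟙 (does (P? (f i)))
  count-tabulate P? {zero} f = sym (sum-0 λ ())
  count-tabulate P? {suc n} f = trans head (sym (sum-suc _))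
    where
    head : ι (length (filter P? (tabulate f))) ≡ 𝟙 (does (P? (f zero))) + sum λ i → 𝟙 (does (P? (f (suc i))))
    head with does (P? (f zero))
    ... | true  = cong (1ℚ +_) (count-tabulate P? (λ i → f (suc i)))
    ... | false = trans (count-tabulate P? (λ i → f (suc i))) (sym (+-identityˡ (sum λ i → 𝟙 (does (P? (f (suc i)))))))

  count-cartesianProduct : ∀ {A B : Set} {P : A × B → Set} (P? : Decidable P) {m n} (f : Fin m → A) (g : Fin n → B) →
    ι (length (filter P? (cartesianProduct (tabulate f) (tabulate g)))) ≡ sum λ i → sum λ j → 𝟙 (does (P? (f i , g j)))
  count-cartesianProduct P? {zero} f g = sym (sum-0 λ ())
  count-cartesianProduct P? {suc m} f g = begin
    ι (length (filter P? (row ++ rest)))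
      ≡⟨ cong (λ xs → ι (length xs)) (filter-++ P? row rest) ⟩
    ι (length (filter P? row ++ filter P? rest))
      ≡⟨ cong ι (length-++ (filter P? row)) ⟩
    ι (length (filter P? row) ℕ.+ length (filter P? rest))
      ≡⟨ ι-+ (length (filter P? row)) (length (filter P? rest)) ⟩
    ι (length (filter P? row)) + ι (length (filter P? rest))
      ≡⟨ cong₂ _+_ (trans (cong (λ xs → ι (length (filter P? xs))) (map-tabulate g (f zero ,_)))
                          (count-tabulate P? (λ j → f zero , g j)))
                   (count-cartesianProduct P? (λ i → f (suc i)) g) ⟩
    (sum λ j → 𝟙 (does (P? (f zero , g j)))) + (sum λ i → sum λ j → 𝟙 (does (P? (f (suc i) , g j))))
      ≡⟨ sum-suc (λ i → sum λ j → 𝟙 (does (P? (f i , g j)))) ⟨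
    (sum λ i → sum λ j → 𝟙 (does (P? (f i , g j)))) ∎
    where
    open ≡-Reasoning
    row = map (f zero ,_) (tabulate g)
    rest = cartesianProduct (tabulate (λ i → f (suc i))) (tabulate g)

  2|E|≤degreeSum : ∀ {n} (G : Graph n) → 2ℚ * ι ∣E G ∣ ≤ degreeSum G
  2|E|≤degreeSum {n} G = begin
    2ℚ * ι ∣E G ∣
      ≡⟨ cong (2ℚ *_) (count-cartesianProduct (Graph.edge? G) id id) ⟩
    2ℚ * ∑∑ G e
      ≡⟨ solve 1 (λ x → con 2ℚ :* x := x :+ x) refl (∑∑ G e) ⟩
    ∑∑ G e + ∑∑ G e
      ≡⟨ cong (∑∑ G e +_) (sum-swap e) ⟩
    ∑∑ G e + ∑∑ G (λ u v → e v u)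
      ≡⟨ ∑∑-+ G e (λ u v → e v u) ⟨
    ∑∑ G (λ u v → e u v + e v u)
      ≤⟨ ∑∑-mono G orient ⟩
    degreeSum G ∎
    where
    open ≤-Reasoning
    e : Fin n → Fin n → ℚ
    e u v = 𝟙 (does (Graph.edge? G (u , v)))
    exclusive : ∀ {P Q : Set} (P? : Dec P) (Q? : Dec Q) b → (P → T b) → (Q → T b) → (P → Q → ⊥) →
      𝟙 (does P?) + 𝟙 (does Q?) ≤ 𝟙 b
    exclusive (yes p) (yes q) b _ _  pq = ⊥-elim (pq p q)
    exclusive (yes p) (no _)  b f _  _  = ≤-trans (≤-reflexive (+-identityʳ 1ℚ)) (1≤𝟙 (f p))
    exclusive (no _)  (yes q) b _ g  _  = ≤-trans (≤-reflexive (+-identityˡ 1ℚ)) (1≤𝟙 (g q))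
    exclusive (no _)  (no _)  b _ _  _  = ≤-trans (≤-reflexive (+-identityʳ 0ℚ)) (0≤𝟙 b)
    orient : ∀ u v → e u v + e v u ≤ a G u v
    orient u v = exclusive (Graph.edge? G (u , v)) (Graph.edge? G (v , u)) (adj G u v)
      proj₂ (λ (_ , v~u) → ~-sym G v~u) (λ (u<v , _) (v<u , _) → <-asym u<v v<u)

  nonZero# : ℚ → ℚ
  nonZero# d = d * recip d

  nonZero#-bounds : ∀ d → 0ℚ ≤ nonZero# d × nonZero# d ≤ 1ℚ
  nonZero#-bounds d with d Data.Rational.≟ 0ℚ
  ... | yes refl = ≤-refl , 0≤1
  ... | no d≢0 = subst (λ x → 0ℚ ≤ x × x ≤ 1ℚ) (sym (*-inverseʳ d {{≢-nonZero d≢0}})) (0≤1 , ≤-refl)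

  sum-𝟙 : ∀ {n} (b : Fin n → Bool) → ∃ λ k → sum (λ i → 𝟙 (b i)) ≡ ι k
  sum-𝟙 {n} b = length (filter (λ i → T? (b i)) (allFin n)) , trans (sum-cong λ i → refl)
    (sym (count-tabulate (λ i → T? (b i)) id))

  module _ {n : ℕ} where

    degree-cases : ∀ (G : Graph n) v → degree G v ≡ 0ℚ ⊎ degree G v ≡ 1ℚ ⊎ 2ℚ ≤ degree G v
    degree-cases G v with sum-𝟙 (adj G v)
    ... | 0           , eq = inj₁ eq
    ... | 1           , eq = inj₂ (inj₁ (trans eq (+-identityʳ 1ℚ)))
    ... | suc (suc k) , eq = inj₂ (inj₂ (p≤p+d (ι k) (0≤ι k) (trans eq (sym (+-assoc 1ℚ 1ℚ (ι k))))))

    1≤degree : ∀ (G : Graph n) {u v} → Graph._~_ G u v → 1ℚ ≤ degree G u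
    1≤degree G {u} {v} u~v = subst (_≤ degree G u) (sum-δ v) (sum-mono λ w → δ≤a w)
      where
      δ≤a : ∀ w → δ v w ≤ a G u w
      δ≤a w with v ≟ w
      ... | yes refl = 1≤𝟙 u~v
      ... | no _     = 0≤𝟙 (adj G u w)

    1≤⇒≢0 : ∀ {p} → 1ℚ ≤ p → p ≢ 0ℚ
    1≤⇒≢0 1≤p refl = <-irrefl refl (<-≤-trans 0<1 1≤p)

    degree-≢0 : ∀ (G : Graph n) {u v} → Graph._~_ G u v → degree G u ≢ 0ℚ
    degree-≢0 G u~v = 1≤⇒≢0 (1≤degree G u~v)

    support≤n : ∀ (G : Graph n) → support G ≤ ι n
    support≤n G = ≤-trans (sum-mono λ v → proj₂ (nonZero#-bounds (degree G v))) (≤-reflexive (sum-1 n))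

    2≤support : ∀ (G : Graph n) {u v} → Graph._~_ G u v → 2ℚ ≤ support G
    2≤support G {u} {v} u~v = begin
      2ℚ                                    ≡⟨ cong₂ _+_ (sum-δ u) (sum-δ v) ⟨
      sum (δ u) + sum (δ v)                 ≡⟨ sum-+ (λ x → refl) ⟨
      sum (λ x → δ u x + δ v x)             ≤⟨ sum-mono endpoint ⟩
      support G                             ∎
      where
      open ≤-Reasoning
      endpoint : ∀ x → δ u x + δ v x ≤ nonZero# (degree G x)
      endpoint x with u ≟ x | v ≟ x
      ... | yes refl | yes refl = ⊥-elim (subst T (irrefl G u) u~v)
      ... | yes refl | no _     = ≤-reflexive (sym (*-recipʳ (degree-≢0 G u~v)))
      ... | no _     | yes refl = ≤-reflexive (sym (*-recipʳ (degree-≢0 G (~-sym G u~v))))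
      ... | no _     | no _     = ≤-trans (≤-reflexive (+-identityʳ 0ℚ)) (proj₁ (nonZero#-bounds (degree G x)))

    keep : Fin n → Fin n → Fin n → Bool
    keep v u w = not (does (v ≟ u)) ∧ not (does (v ≟ w))

    -- The vertex is isolated and not removed, so all graphs of the peeling live on `Fin n` and
    -- sizes are measured by `support`.
    delete : Fin n → Graph n → Graph n
    delete v G = record
      { adj    = λ u w → adj G u w ∧ keep v u w
      ; symm   = λ u w → cong₂ _∧_ (symm G u w) (∧-comm (not (does (v ≟ u))) (not (does (v ≟ w))))
      ; irrefl = λ u → cong (_∧ keep v u u) (irrefl G u)
      }

    infix 4 _⊆_
    _⊆_ : Graph n → Graph n → Set
    H ⊆ G = ∀ {u v} → Graph._~_ H u v → Graph._~_ G u v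

    ⊆-bipartite : ∀ {H G : Graph n} → H ⊆ G → Bipartite G → Bipartite H
    ⊆-bipartite H⊆G (c , proper) = c , λ u v e → proper u v (H⊆G e)

    ⊆-free : ∀ {𝓕} {H G : Graph n} → H ⊆ G → Free 𝓕 G → Free 𝓕 H
    ⊆-free H⊆G = All.map λ ¬copy (f , inj , hom) → ¬copy (f , inj , λ u v e → H⊆G (hom u v e))

    degree-mono : ∀ {H G : Graph n} → H ⊆ G → ∀ v → degree H v ≤ degree G v
    degree-mono {H} {G} H⊆G v = sum-mono λ w → 𝟙-mono (H⊆G {v} {w})
      where
      𝟙-mono : ∀ {b c} → (T b → T c) → 𝟙 b ≤ 𝟙 c
      𝟙-mono {true}      b⇒c = 1≤𝟙 (b⇒c _)
      𝟙-mono {false} {c} _   = 0≤𝟙 c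

    nonZero#-mono : ∀ {d e} → 0ℚ ≤ d → d ≤ e → nonZero# d ≤ nonZero# e
    nonZero#-mono {d} {e} 0≤d d≤e with e Data.Rational.≟ 0ℚ
    ... | yes refl = ≤-reflexive (cong nonZero# (≤-antisym d≤e 0≤d))
    ... | no e≢0   = ≤-trans (proj₂ (nonZero#-bounds d)) (≤-reflexive (sym (*-inverseʳ e {{≢-nonZero e≢0}})))

    0≤degree : ∀ (G : Graph n) v → 0ℚ ≤ degree G v
    0≤degree G v = sum-0≤ λ w → 0≤𝟙 (adj G v w)

    support-mono : ∀ {H G : Graph n} → H ⊆ G → support H ≤ support G
    support-mono {H} {G} H⊆G = sum-mono λ v → nonZero#-mono (0≤degree H v) (degree-mono {H} {G} H⊆G v)

    delete-⊆ : ∀ v (G : Graph n) → delete v G ⊆ G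
    delete-⊆ v G e = proj₁ (Equivalence.to T-∧ e)

    module _ (G : Graph n) (v : Fin n) (leaf : degree G v ≡ 1ℚ) where
      private
        G′ : Graph n
        G′ = delete v G

      -- Row v and column v of the adjacency matrix are lost, each of sum 1; they meet only in the
      -- diagonal entry, which is 0.
      degreeSum-delete : degreeSum G ≡ degreeSum G′ + 2ℚ
      degreeSum-delete = begin
        degreeSum G
          ≡⟨ ∑∑-cong G split ⟩
        ∑∑ G (λ u w → a G′ u w + (δ v u * a G u w + δ v w * a G u w))
          ≡⟨ ∑∑-+ G (a G′) (λ u w → δ v u * a G u w + δ v w * a G u w) ⟩
        degreeSum G′ + ∑∑ G (λ u w → δ v u * a G u w + δ v w * a G u w)
          ≡⟨ cong (degreeSum G′ +_) (∑∑-+ G (λ u w → δ v u * a G u w) (λ u w → δ v w * a G u w)) ⟩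
        degreeSum G′ + (∑∑ G (λ u w → δ v u * a G u w) + ∑∑ G (λ u w → δ v w * a G u w))
          ≡⟨ cong (degreeSum G′ +_) (cong₂ _+_ rows columns) ⟩
        degreeSum G′ + 2ℚ ∎
        where
        open ≡-Reasoning
        rows : ∑∑ G (λ u w → δ v u * a G u w) ≡ 1ℚ
        rows = trans (sum-cong λ u → sum-* (δ v u) λ w → refl) (trans (sum-δ-* v (degree G)) leaf)
        columns : ∑∑ G (λ u w → δ v w * a G u w) ≡ 1ℚ
        columns = trans (sum-cong λ u → trans (sum-δ-* v (a G u)) (cong 𝟙 (symm G u v))) leaf
        split : ∀ u w → a G u w ≡ a G′ u w + (δ v u * a G u w + δ v w * a G u w)
        split u w with v ≟ u | v ≟ w
        ... | yes refl | yes refl rewrite irrefl G v = refl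
        ... | yes refl | no _ rewrite ∧-zeroʳ (adj G v w) =
          solve 1 (λ x → x := con 0ℚ :+ (con 1ℚ :* x :+ con 0ℚ :* x)) refl (a G v w)
        ... | no _ | yes refl rewrite ∧-zeroʳ (adj G u v) =
          solve 1 (λ x → x := con 0ℚ :+ (con 0ℚ :* x :+ con 1ℚ :* x)) refl (a G u v)
        ... | no _ | no _ rewrite ∧-comm (adj G u w) true =
          solve 1 (λ x → x := x :+ (con 0ℚ :* x :+ con 0ℚ :* x)) refl (a G u w)

      -- The vertex v leaves the support; its neighbour may leave too, hence only an inequality.
      support-delete : support G′ + 1ℚ ≤ support G
      support-delete = begin
        support G′ + 1ℚ                                    ≡⟨ cong (support G′ +_) (sum-δ v) ⟨
        support G′ + sum (δ v)                             ≡⟨ sum-+ (λ u → refl) ⟨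
        sum (λ u → nonZero# (degree G′ u) + δ v u)         ≤⟨ sum-mono pointwise ⟩
        support G                                          ∎
        where
        open ≤-Reasoning
        isolated : degree G′ v ≡ 0ℚ
        isolated = sum-0 none
          where
          none : ∀ w → a G′ v w ≡ 0ℚ
          none w with v ≟ v
          ... | yes _  = cong 𝟙 (∧-zeroʳ (adj G v w))
          ... | no v≢v = ⊥-elim (v≢v refl)
        pointwise : ∀ u → nonZero# (degree G′ u) + δ v u ≤ nonZero# (degree G u)
        pointwise u with zeroOrOne-𝟙 (does (v ≟ u))
        ... | inj₂ (δ≡1 , t) = ≤-reflexive (trans (cong₂ _+_ (cong nonZero# (trans (cong (degree G′) (sym (T-does⇒≡ t))) isolated)) δ≡1)
          (sym (*-recipʳ (1≤⇒≢0 (≤-reflexive (trans (sym leaf) (cong (degree G) (T-does⇒≡ t))))))))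
        ... | inj₁ δ≡0 = ≤-trans
          (≤-reflexive (trans (cong (nonZero# (degree G′ u) +_) δ≡0) (+-identityʳ (nonZero# (degree G′ u)))))
          (nonZero#-mono (0≤degree G′ u) (degree-mono {G′} {G} (λ {u} {w} → delete-⊆ v G {u} {w}) u))

      leaf-edge : ∃ λ w → Graph._~_ G v w
      leaf-edge with any? (λ w → T? (adj G v w))
      ... | yes e = e
      ... | no ¬e = ⊥-elim (1≤⇒≢0 (≤-reflexive (sym leaf)) (sum-0 λ w → 𝟙-false λ t → ¬e (w , t)))

    -- Deleting a leaf costs 2 in the degree sum and at least 1 in the support, so degreeSum - 2 *
    -- support never drops; this is `excess`. If nothing survives, the deletion of the last edge
    -- empties two vertices at once, which yields the extra 2 in `forest`.
    record Core (G : Graph n) : Set where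
      field
        core       : Graph n
        core⊆      : core ⊆ G
        2≤degree   : ∀ {u v} → Graph._~_ core u v → 2ℚ ≤ degree core v
        excess     : degreeSum G + 2ℚ * support core ≤ degreeSum core + 2ℚ * support G
        forest     : degreeSum core ≡ 0ℚ → degreeSum G ≡ 0ℚ ⊎ degreeSum G + 2ℚ ≤ 2ℚ * support G

    0≤degreeSum : ∀ (G : Graph n) → 0ℚ ≤ degreeSum G
    0≤degreeSum G = sum-0≤ (0≤degree G)

    degreeSum≤n*n : ∀ (G : Graph n) → degreeSum G ≤ ι (n ℕ.* n)
    degreeSum≤n*n G = ≤-trans
      (sum-mono λ u → ≤-trans (sum-mono λ v → 𝟙≤1 (adj G u v)) (≤-reflexive (sum-1 n)))
      (≤-reflexive (sum-const n))
      where
      𝟙≤1 : ∀ b → 𝟙 b ≤ 1ℚ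
      𝟙≤1 true  = ≤-refl
      𝟙≤1 false = 0≤1
      sum-const : ∀ m → sum {m} (λ _ → ι n) ≡ ι (m ℕ.* n)
      sum-const zero    = sum-0 λ ()
      sum-const (suc m) = trans (sum-suc {m} (λ _ → ι n)) (trans (cong (ι n +_) (sum-const m)) (sym (ι-+ n (m ℕ.* n))))

    -- The number `k` is fuel: degree sums are rationals, and each deletion lowers them by 2, hence
    -- by at least 1.
    core-exists : ∀ k (G : Graph n) → degreeSum G ≤ ι k → Core G
    core-exists k G D≤k with any? (λ v → degree G v Data.Rational.≟ 1ℚ)
    ... | no ¬leaf = record
      { core = G ; core⊆ = λ e → e ; 2≤degree = λ {u} {v} → big u v ; excess = ≤-refl ; forest = inj₁ }
      where
      big : ∀ u v → Graph._~_ G u v → 2ℚ ≤ degree G v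
      big u v u~v with degree-cases G v
      ... | inj₁ d≡0        = ⊥-elim (degree-≢0 G (~-sym G u~v) d≡0)
      ... | inj₂ (inj₁ d≡1) = ⊥-elim (¬leaf (v , d≡1))
      ... | inj₂ (inj₂ 2≤d) = 2≤d
    core-exists zero G D≤0 | yes (v , leaf) = ⊥-elim (1≤⇒≢0 1≤0 refl)
      where
      1≤0 : 1ℚ ≤ 0ℚ
      1≤0 = ≤-trans (p≤p+d (degreeSum (delete v G) + 1ℚ) (0≤p+q (0≤degreeSum (delete v G)) 0≤1)
        (trans (degreeSum-delete G v leaf)
          (solve 1 (λ d → d :+ con 2ℚ := con 1ℚ :+ (d :+ con 1ℚ)) refl (degreeSum (delete v G))))) D≤0
    core-exists (suc k) G D≤k | yes (v , leaf) = record
      { core = core ; core⊆ = λ e → delete-⊆ v G (core⊆ e) ; 2≤degree = 2≤degree ; excess = excess′ ; forest = forest′ }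
      where
      open ≤-Reasoning
      G′ : Graph n
      G′ = delete v G
      D′ : degreeSum G ≡ degreeSum G′ + 2ℚ
      D′ = degreeSum-delete G v leaf
      smaller : degreeSum G′ ≤ ι k
      smaller = begin
        degreeSum G′            ≤⟨ p≤p+d 1ℚ 0≤1 (solve 1 (λ d → d :+ con 2ℚ :- con 1ℚ := d :+ con 1ℚ) refl (degreeSum G′)) ⟩
        degreeSum G′ + 2ℚ - 1ℚ  ≡⟨ cong (_- 1ℚ) D′ ⟨
        degreeSum G - 1ℚ        ≤⟨ +-monoˡ-≤ (- 1ℚ) D≤k ⟩
        1ℚ + ι k - 1ℚ           ≡⟨ solve 1 (λ x → con 1ℚ :+ x :- con 1ℚ := x) refl (ι k) ⟩
        ι k                     ∎
      open Core (core-exists k G′ smaller)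
      2support : 2ℚ * support G′ + 2ℚ ≤ 2ℚ * support G
      2support = ≤-trans (≤-reflexive (solve 1 (λ x → con 2ℚ :* x :+ con 2ℚ := con 2ℚ :* (x :+ con 1ℚ)) refl (support G′)))
        (*-monoˡ-≤ 2ℚ 0≤2 (support-delete G v leaf))
      excess′ : degreeSum G + 2ℚ * support core ≤ degreeSum core + 2ℚ * support G
      excess′ = begin
        degreeSum G + 2ℚ * support core
          ≡⟨ cong (_+ 2ℚ * support core) D′ ⟩
        degreeSum G′ + 2ℚ + 2ℚ * support core
          ≡⟨ solve 3 (λ x y z → x :+ y :+ z := (x :+ z) :+ y) refl (degreeSum G′) 2ℚ (2ℚ * support core) ⟩
        degreeSum G′ + 2ℚ * support core + 2ℚ
          ≤⟨ +-monoˡ-≤ 2ℚ excess ⟩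
        degreeSum core + 2ℚ * support G′ + 2ℚ
          ≡⟨ +-assoc (degreeSum core) (2ℚ * support G′) 2ℚ ⟩
        degreeSum core + (2ℚ * support G′ + 2ℚ)
          ≤⟨ +-monoʳ-≤ (degreeSum core) 2support ⟩
        degreeSum core + 2ℚ * support G ∎
      forest′ : degreeSum core ≡ 0ℚ → degreeSum G ≡ 0ℚ ⊎ degreeSum G + 2ℚ ≤ 2ℚ * support G
      forest′ empty = inj₂ (many (forest empty))
        where
        many : degreeSum G′ ≡ 0ℚ ⊎ degreeSum G′ + 2ℚ ≤ 2ℚ * support G′ → degreeSum G + 2ℚ ≤ 2ℚ * support G
        many (inj₁ D′≡0) = begin
          degreeSum G + 2ℚ          ≡⟨ cong (_+ 2ℚ) (trans D′ (cong (_+ 2ℚ) D′≡0)) ⟩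
          2ℚ * 2ℚ                   ≤⟨ *-monoˡ-≤ 2ℚ 0≤2 (2≤support G (proj₂ (leaf-edge G v leaf))) ⟩
          2ℚ * support G            ∎
        many (inj₂ D′+2≤) = begin
          degreeSum G + 2ℚ          ≡⟨ cong (_+ 2ℚ) D′ ⟩
          degreeSum G′ + 2ℚ + 2ℚ    ≤⟨ +-monoˡ-≤ 2ℚ D′+2≤ ⟩
          2ℚ * support G′ + 2ℚ      ≤⟨ 2support ⟩
          2ℚ * support G            ∎

-- From the core to an edge bound at a rational approximation of q.

module MooreBound where
  open import Data.Bool.Properties using (T?)
  open import Data.Empty using (⊥-elim)
  open import Data.Fin.Properties using (any?)
  open import Data.Integer as ℤ using (+_)
  import Data.Integer.Properties as ℤₚ
  open import Data.Nat as ℕ using (ℕ; zero; suc)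
  open import Data.Product using (∃; _×_; _,_; proj₁; proj₂)
  open import Data.Rational
  open import Data.Rational.Properties
  open import Data.Rational.Solver using (module +-*-Solver)
  open import Data.Rational.Unnormalised as ℚᵘ using (mkℚᵘ)
  import Data.Rational.Unnormalised.Properties as ℚᵘₚ
  open import Data.Sum using (_⊎_; inj₁; inj₂)
  open import Relation.Binary.PropositionalEquality
    using (_≡_; refl; sym; trans; cong; module ≡-Reasoning)
  open import Relation.Nullary using (¬_; yes; no)
  open import Defs using (Graph; adj; Bipartite; Free; 𝓒; ∣E_∣)
  open RationalInequalities
  open FiniteSums
  open NonBacktrackingWalks
  open Endpoints using (shortWalks-≤n)
  open Peeling
  open Counting using (_~_; ~-sym; degree; degreeSum; support)
  open +-*-Solver

  module _ {n : ℕ} (G : Graph n) (2≤deg : ∀ {u v} → Graph._~_ G u v → 2ℚ ≤ degree G v) where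

    2*support≤degreeSum : 2ℚ * support G ≤ degreeSum G
    2*support≤degreeSum = ≤-trans (≤-reflexive (sym (sum-* 2ℚ λ v → refl))) (sum-mono pointwise)
      where
      pointwise : ∀ v → 2ℚ * nonZero# (degree G v) ≤ degree G v
      pointwise v with degree-cases G v
      ... | inj₁ d≡0 = ≤-reflexive (trans (cong (λ d → 2ℚ * nonZero# d) d≡0) (sym d≡0))
      ... | inj₂ (inj₁ d≡1) = ⊥-elim (<⇒≱ 1<2 (≤-trans (2≤deg (~-sym G (proj₂ (leaf-edge G v d≡1)))) (≤-reflexive d≡1)))
        where
        1<2 : 1ℚ < 2ℚ
        1<2 = +-monoʳ-< 1ℚ 0<1
      ... | inj₂ (inj₂ 2≤d) = ≤-trans (*-monoˡ-≤ 2ℚ 0≤2 (proj₂ (nonZero#-bounds (degree G v)))) 2≤d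

  -- In the third case t + 1 is the average degree of the core of G.
  trichotomy : ∀ {ℓ n} (G : Graph n) → Bipartite G → Free (𝓒 ℓ) G →
    degreeSum G ≡ 0ℚ ⊎ degreeSum G + 2ℚ ≤ 2ℚ * ι n ⊎
    ∃ λ t → 1ℚ ≤ t × 2ℚ * geometric t ℓ ≤ ι n × degreeSum G ≤ (t + 1ℚ) * ι n
  trichotomy {ℓ} {n} G bip free with core-exists (n ℕ.* n) G (degreeSum≤n*n G)
  ... | record { core = H ; core⊆ = H⊆G ; 2≤degree = 2≤deg ; excess = excess ; forest = forest }
    with any? (λ u → any? λ v → T? (adj H u v))
  ... | no ¬edge = edgeless (forest (sum-0 λ u → sum-0 λ v → 𝟙-false λ u~v → ¬edge (u , v , u~v)))
    where
    edgeless : degreeSum G ≡ 0ℚ ⊎ degreeSum G + 2ℚ ≤ 2ℚ * support G → _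
    edgeless (inj₁ D≡0)  = inj₁ D≡0
    edgeless (inj₂ D+2≤) = inj₂ (inj₁ (≤-trans D+2≤ (*-monoˡ-≤ 2ℚ 0≤2 (support≤n G))))
  ... | yes (u₀ , v₀ , e₀) = inj₂ (inj₂ (t , 1≤t ,
          Growth.moore H t 1≤t 2≤deg mean ℓ 0<D (shortWalks-≤n H {ℓ} (⊆-bipartite {H = H} {G} H⊆G bip) (⊆-free {𝓕 = 𝓒 ℓ} {H} {G} H⊆G free)) , (begin
            degreeSum G
              ≡⟨ solve 2 (λ d h → d := (d :+ con 2ℚ :* h) :+ :- (con 2ℚ :* h)) refl (degreeSum G) (support H) ⟩
            degreeSum G + 2ℚ * support H + - (2ℚ * support H)
              ≤⟨ +-monoˡ-≤ (- (2ℚ * support H)) excess ⟩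
            degreeSum H + 2ℚ * support G + - (2ℚ * support H)
              ≡⟨ cong (λ x → x + 2ℚ * support G + - (2ℚ * support H)) mean ⟩
            (t + 1ℚ) * support H + 2ℚ * support G + - (2ℚ * support H)
              ≡⟨ solve 3 (λ t h g → (t :+ con 1ℚ) :* h :+ con 2ℚ :* g :+ :- (con 2ℚ :* h)
                   := con 2ℚ :* g :+ (t :- con 1ℚ) :* h) refl t (support H) (support G) ⟩
            2ℚ * support G + (t - 1ℚ) * support H
              -- As `t` is at least 1, a vertex lost in the peeling, which accounts for 2 in the
              -- bound so far, may be charged `t + 1` like those of the core.
              ≤⟨ +-monoʳ-≤ (2ℚ * support G) (*-monoˡ-≤ (t - 1ℚ) (p≤q⇒0≤q-p 1≤t) support≤) ⟩
            2ℚ * support G + (t - 1ℚ) * support G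
              ≡⟨ solve 2 (λ t g → con 2ℚ :* g :+ (t :- con 1ℚ) :* g := (t :+ con 1ℚ) :* g) refl t (support G) ⟩
            (t + 1ℚ) * support G
              ≤⟨ *-monoˡ-≤ (t + 1ℚ) (0≤p+q (≤-trans 0≤1 1≤t) 0≤1) (support≤n G) ⟩
            (t + 1ℚ) * ι n ∎)))
    where
    open ≤-Reasoning
    N D t : ℚ
    N = support H
    D = degreeSum H
    t = D * recip N - 1ℚ
    0<N : 0ℚ < N
    0<N = <-≤-trans (positive⁻¹ 2ℚ) (2≤support H e₀)
    2N≤D : 2ℚ * N ≤ D
    2N≤D = 2*support≤degreeSum H 2≤deg
    0<D : 0ℚ < D
    0<D = <-≤-trans 0<N (≤-trans (p≤p+d N (<⇒≤ 0<N) (solve 1 (λ x → con 2ℚ :* x := x :+ x) refl N)) 2N≤D)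
    1≤t : 1ℚ ≤ t
    1≤t = begin
      1ℚ                          ≡⟨ cong (λ x → 2ℚ * x - 1ℚ) (*-recipʳ-pos 0<N) ⟨
      2ℚ * (N * recip N) - 1ℚ     ≡⟨ cong (_- 1ℚ) (*-assoc 2ℚ N (recip N)) ⟨
      2ℚ * N * recip N - 1ℚ       ≤⟨ +-monoˡ-≤ (- 1ℚ) (*-monoʳ-≤-nonNeg (recip N) {{nonNegative (0≤recip (<⇒≤ 0<N))}} 2N≤D) ⟩
      t                           ∎
    mean : D ≡ (t + 1ℚ) * N
    mean = sym (trans (solve 3 (λ d r n → (d :* r :- con 1ℚ :+ con 1ℚ) :* n := d :* (n :* r)) refl D (recip N) N)
      (trans (cong (D *_) (*-recipʳ-pos 0<N)) (*-identityʳ D)))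
    support≤ : N ≤ support G
    support≤ = support-mono {H = H} {G} H⊆G

  ι≡/1 : ∀ n → + n / 1 ≡ ι n
  ι≡/1 zero    = refl
  ι≡/1 (suc n) = trans (toℚᵘ-injective (begin
      toℚᵘ (+ suc n / 1)                   ≈⟨ toℚᵘ-fromℚᵘ (mkℚᵘ (+ suc n) 0) ⟩
      mkℚᵘ (+ suc n) 0                     ≈⟨ ℚᵘ.*≡* (cong (λ x → (+ 1 ℤ.+ x) ℤ.* + 1) (sym (ℤₚ.*-identityʳ (+ n)))) ⟩
      ℚᵘ.1ℚᵘ ℚᵘ.+ mkℚᵘ (+ n) 0             ≈⟨ ℚᵘₚ.+-congʳ ℚᵘ.1ℚᵘ (ℚᵘₚ.≃-sym (toℚᵘ-fromℚᵘ (mkℚᵘ (+ n) 0))) ⟩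
      toℚᵘ 1ℚ ℚᵘ.+ toℚᵘ (+ n / 1)          ≈⟨ toℚᵘ-homo-+ 1ℚ (+ n / 1) ⟨
      toℚᵘ (1ℚ + + n / 1)                  ∎))
    (cong (_+_ 1ℚ) (ι≡/1 n))
    where open ℚᵘₚ.≃-Reasoning

  ^-mono : ∀ {x y} → 0ℚ ≤ x → x ≤ y → ∀ k → 0ℚ ≤ x ^ k × x ^ k ≤ y ^ k
  ^-mono 0≤x x≤y zero    = 0≤1 , ≤-refl
  ^-mono 0≤x x≤y (suc k) = let 0≤x^k , x^k≤y^k = ^-mono 0≤x x≤y k in
    0≤p*q 0≤x 0≤x^k , *-mono-≤ (≤-trans 0≤x x≤y) 0≤x^k x≤y x^k≤y^k

  -- The linear term alone grows by y - x and the other terms do not decrease. This makes the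
  -- inverse of the geometric sum quantitatively continuous.
  geometric-growth : ∀ {x y} → 0ℚ ≤ x → x ≤ y → ∀ k → geometric x (suc k) + (y - x) ≤ geometric y (suc k)
  geometric-growth {x} {y} 0≤x x≤y zero = ≤-reflexive
    (solve 2 (λ x y → x :* con 1ℚ :+ con 1ℚ :+ (y :- x) := y :* con 1ℚ :+ con 1ℚ) refl x y)
  geometric-growth {x} {y} 0≤x x≤y (suc k) = ≤-trans
    (≤-reflexive (+-assoc (x ^ suc (suc k)) (geometric x (suc k)) (y - x)))
    (+-mono-≤ (proj₂ (^-mono 0≤x x≤y (suc (suc k)))) (geometric-growth 0≤x x≤y k))

  [1-x]*geometric : ∀ x k → (1ℚ - x) * geometric x k ≡ 1ℚ - x ^ suc k
  [1-x]*geometric x zero    = solve 1 (λ x → (con 1ℚ :- x) :* con 1ℚ := con 1ℚ :- x :* con 1ℚ) refl x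
  [1-x]*geometric x (suc k) = begin
    (1ℚ - x) * (x ^ suc k + geometric x k)
      ≡⟨ *-distribˡ-+ (1ℚ - x) (x ^ suc k) (geometric x k) ⟩
    (1ℚ - x) * x ^ suc k + (1ℚ - x) * geometric x k
      ≡⟨ cong (λ y → (1ℚ - x) * x ^ suc k + y) ([1-x]*geometric x k) ⟩
    (1ℚ - x) * x ^ suc k + (1ℚ - x ^ suc k)
      ≡⟨ solve 2 (λ x p → (con 1ℚ :- x) :* p :+ (con 1ℚ :- p) := con 1ℚ :- x :* p) refl x (x ^ suc k) ⟩
    1ℚ - x ^ suc (suc k) ∎
    where open ≡-Reasoning

  module _ {n ℓ : ℕ} {x δ : ℚ} (0≤x : 0ℚ ≤ x) (0≤δ : 0ℚ ≤ δ) (close : ι n ≤ 2ℚ * geometric x (suc ℓ) + δ) where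

    private
      -- The core case costs δ for each of the n vertices and the forest case δ once. The summand 1
      -- also keeps the factor positive for n = 0, so δ can be recovered from the error by division.
      ε : ℚ
      ε = δ * (1ℚ + ι n)

    0≤[x+1]n : 0ℚ ≤ (x + 1ℚ) * ι n
    0≤[x+1]n = 0≤p*q (0≤p+q 0≤x 0≤1) (0≤ι n)

    δ≤ε : δ ≤ ε
    δ≤ε = p≤p+d (δ * ι n) (0≤p*q 0≤δ (0≤ι n)) (solve 2 (λ d n → d :* (con 1ℚ :+ n) := d :+ d :* n) refl δ (ι n))

    -- Only (1 - x) * n ≤ 2 + δ is needed. It is clear for x ≥ 1; for x ≤ 1 the telescoped geometric
    -- sum turns `close` into (1 - x) * n ≤ 2 * (1 - x ^ (ℓ + 2)) + (1 - x) * δ.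
    forest-bound : ∀ {D} → D + 2ℚ ≤ 2ℚ * ι n → D ≤ (x + 1ℚ) * ι n + ε
    forest-bound {D} D+2≤2n = begin
      D                                ≡⟨ solve 1 (λ d → d := d :+ con 2ℚ :- con 2ℚ) refl D ⟩
      D + 2ℚ - 2ℚ                      ≤⟨ +-monoˡ-≤ (- 2ℚ) D+2≤2n ⟩
      2ℚ * ι n - 2ℚ                    ≡⟨ solve 2 (λ x n → con 2ℚ :* n :- con 2ℚ := (x :+ con 1ℚ) :* n :+ ((con 1ℚ :- x) :* n :- con 2ℚ)) refl x (ι n) ⟩
      (x + 1ℚ) * ι n + ((1ℚ - x) * ι n - 2ℚ) ≤⟨ +-monoʳ-≤ ((x + 1ℚ) * ι n) (≤-trans deficit δ≤ε) ⟩
      (x + 1ℚ) * ι n + ε               ∎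
      where
      open ≤-Reasoning
      deficit : (1ℚ - x) * ι n - 2ℚ ≤ δ
      deficit with ≤-total x 1ℚ
      ... | inj₂ 1≤x = ≤-trans (p≤p+d ((x - 1ℚ) * ι n + 2ℚ) (0≤p+q (0≤p*q (p≤q⇒0≤q-p 1≤x) (0≤ι n)) 0≤2)
          (solve 2 (λ x n → con 0ℚ := ((con 1ℚ :- x) :* n :- con 2ℚ) :+ ((x :- con 1ℚ) :* n :+ con 2ℚ)) refl x (ι n))) 0≤δ
      ... | inj₁ x≤1 = begin
        (1ℚ - x) * ι n - 2ℚ
          ≤⟨ +-monoˡ-≤ (- 2ℚ) (*-monoˡ-≤ (1ℚ - x) (p≤q⇒0≤q-p x≤1) close) ⟩
        (1ℚ - x) * (2ℚ * geometric x (suc ℓ) + δ) - 2ℚ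
          ≡⟨ solve 3 (λ x g d → (con 1ℚ :- x) :* (con 2ℚ :* g :+ d) :- con 2ℚ
               := con 2ℚ :* ((con 1ℚ :- x) :* g) :+ (con 1ℚ :- x) :* d :- con 2ℚ) refl x (geometric x (suc ℓ)) δ ⟩
        2ℚ * ((1ℚ - x) * geometric x (suc ℓ)) + (1ℚ - x) * δ - 2ℚ
          ≡⟨ cong (λ y → 2ℚ * y + (1ℚ - x) * δ - 2ℚ) ([1-x]*geometric x (suc ℓ)) ⟩
        2ℚ * (1ℚ - x ^ suc (suc ℓ)) + (1ℚ - x) * δ - 2ℚ
          ≤⟨ p≤p+d (2ℚ * x ^ suc (suc ℓ) + x * δ)
               (0≤p+q (0≤p*q 0≤2 (proj₁ (^-mono 0≤x ≤-refl (suc (suc ℓ))))) (0≤p*q 0≤x 0≤δ))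
               (solve 3 (λ x p d → d := con 2ℚ :* (con 1ℚ :- p) :+ (con 1ℚ :- x) :* d :- con 2ℚ :+ (con 2ℚ :* p :+ x :* d))
                 refl x (x ^ suc (suc ℓ)) δ) ⟩
        δ ∎

    -- If t exceeds x, then `geometric-growth` between `few` and `close` leaves room for 2 * (t - x)
    -- ≤ δ at most, of which t ≤ x + δ is kept.
    core-bound : ∀ {D t} → 2ℚ * geometric t (suc ℓ) ≤ ι n → D ≤ (t + 1ℚ) * ι n → D ≤ (x + 1ℚ) * ι n + ε
    core-bound {D} {t} few D≤ = begin
      D                              ≤⟨ D≤ ⟩
      (t + 1ℚ) * ι n                 ≤⟨ *-monoʳ-≤-nonNeg (ι n) {{nonNegative (0≤ι n)}} (+-monoˡ-≤ 1ℚ t≤x+δ) ⟩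
      (x + δ + 1ℚ) * ι n             ≤⟨ p≤p+d δ 0≤δ (solve 3 (λ x d n → (x :+ con 1ℚ) :* n :+ d :* (con 1ℚ :+ n)
                                          := (x :+ d :+ con 1ℚ) :* n :+ d) refl x δ (ι n)) ⟩
      (x + 1ℚ) * ι n + ε             ∎
      where
      open ≤-Reasoning
      t≤x+δ : t ≤ x + δ
      t≤x+δ with ≤-total t x
      ... | inj₁ t≤x = ≤-trans t≤x (p≤p+d δ 0≤δ refl)
      ... | inj₂ x≤t = begin
        t
          ≤⟨ p≤p+d (t - x) (p≤q⇒0≤q-p x≤t)
               (solve 3 (λ t x g → con 2ℚ :* (g :+ (t :- x)) :+ (x :- con 2ℚ :* g) := t :+ (t :- x)) refl t x (geometric x (suc ℓ))) ⟩
        2ℚ * (geometric x (suc ℓ) + (t - x)) + (x - 2ℚ * geometric x (suc ℓ))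
          ≤⟨ +-monoˡ-≤ (x - 2ℚ * geometric x (suc ℓ)) (*-monoˡ-≤ 2ℚ 0≤2 (geometric-growth 0≤x x≤t ℓ)) ⟩
        2ℚ * geometric t (suc ℓ) + (x - 2ℚ * geometric x (suc ℓ))
          ≤⟨ +-monoˡ-≤ (x - 2ℚ * geometric x (suc ℓ)) (≤-trans few close) ⟩
        2ℚ * geometric x (suc ℓ) + δ + (x - 2ℚ * geometric x (suc ℓ))
          ≡⟨ solve 3 (λ g d x → con 2ℚ :* g :+ d :+ (x :- con 2ℚ :* g) := x :+ d) refl (geometric x (suc ℓ)) δ x ⟩
        x + δ ∎

    edge-bound : (G : Graph n) → Bipartite G → Free (𝓒 (suc ℓ)) G →
      ι ∣E G ∣ ≤ ½ * (x + 1ℚ) * ι n + ε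
    edge-bound G bip free = begin
      ι ∣E G ∣                            ≡⟨ solve 1 (λ m → m := con ½ :* (con 2ℚ :* m)) refl (ι ∣E G ∣) ⟩
      ½ * (2ℚ * ι ∣E G ∣)                 ≤⟨ *-monoˡ-≤ ½ (nonNegative⁻¹ ½) (≤-trans (2|E|≤degreeSum G) (bound (trichotomy {suc ℓ} G bip free))) ⟩
      ½ * ((x + 1ℚ) * ι n + ε)            ≤⟨ p≤p+d (½ * ε) (0≤p*q (nonNegative⁻¹ ½) (≤-trans 0≤δ δ≤ε))
                                               (solve 3 (λ x n e → con ½ :* (x :+ con 1ℚ) :* n :+ e
                                                 := con ½ :* ((x :+ con 1ℚ) :* n :+ e) :+ con ½ :* e) refl x (ι n) ε) ⟩
      ½ * (x + 1ℚ) * ι n + ε              ∎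
      where
      open ≤-Reasoning
      bound : _ → degreeSum G ≤ (x + 1ℚ) * ι n + ε
      bound (inj₁ D≡0) = ≤-trans (≤-reflexive D≡0) (0≤p+q 0≤[x+1]n (≤-trans 0≤δ δ≤ε))
      bound (inj₂ (inj₁ D+2≤2n)) = forest-bound D+2≤2n
      bound (inj₂ (inj₂ (t , _ , few , D≤))) = core-bound {t = t} few D≤

-- Passage from rational approximations to the real q.

open import Data.Nat using (ℕ; _≥_)
open import Data.Rational using (½)
open import Defs

private
  module Limit where
    open import Data.Nat as ℕ using (suc)
    import Data.Nat.Properties as ℕₚ
    open import Data.Product using (_,_)
    import Data.Rational as ℚ
    import Data.Rational.Properties as ℚₚ
    open import Data.Rational.Solver using (module +-*-Solver)
    open import Relation.Binary.PropositionalEquality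
      using (_≡_; refl; sym; trans; cong; cong₂; subst₂)
    open RationalInequalities
    open FiniteSums using (ι; geometric)
    open Peeling using (0≤ι)
    open MooreBound using (ι≡/1; edge-bound)

    seq-^ : ∀ q k i → seq (q ^ k) i ≡ seq q i FiniteSums.^ k
    seq-^ q ℕ.zero  i = refl
    seq-^ q (suc k) i = cong (seq q i ℚ.*_) (seq-^ q k i)

    seq-geometricSum : ∀ q k i → seq (geometricSum q k) i ≡ geometric (seq q i) k
    seq-geometricSum q ℕ.zero  i = refl
    seq-geometricSum q (suc k) i = cong₂ ℚ._+_ (seq-^ q (suc k) i) (seq-geometricSum q k i)

    ∣p-q∣≤d⇒p≤q+d : ∀ {p q d} → ℚ.∣ p ℚ.- q ∣ ℚ.≤ d → p ℚ.≤ q ℚ.+ d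
    ∣p-q∣≤d⇒p≤q+d {p} {q} {d} close = begin
      p                        ≡⟨ solve 2 (λ p q → p := q :+ (p :- q)) refl p q ⟩
      q ℚ.+ (p ℚ.- q)          ≤⟨ ℚₚ.+-monoʳ-≤ q (≤∣∣ (p ℚ.- q)) ⟩
      q ℚ.+ ℚ.∣ p ℚ.- q ∣      ≤⟨ ℚₚ.+-monoʳ-≤ q close ⟩
      q ℚ.+ d                  ∎
      where
      open ℚₚ.≤-Reasoning
      open +-*-Solver
      open import Data.Sum using (inj₁; inj₂)
      ≤∣∣ : ∀ x → x ℚ.≤ ℚ.∣ x ∣
      ≤∣∣ x with ℚₚ.≤-total ℚ.0ℚ x
      ... | inj₁ 0≤x = ℚₚ.≤-reflexive (sym (ℚₚ.0≤p⇒∣p∣≡p 0≤x))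
      ... | inj₂ x≤0 = ℚₚ.≤-trans x≤0 (ℚₚ.0≤∣p∣ x)

    -- Real operations act index by index and the order allows a tolerance ε, so `edge-bound` is
    -- applied at each late index. The choice δ = ε / (1 + n) makes its error exactly ε; beyond `M`
    -- the approximations of q are nonnegative, beyond `N` the equation for n holds up to δ.
    attained-bound : ∀ {ℓ n m} → Attained n (𝓒 (suc ℓ)) m → (q : ℝ) → fromℕ 0 < q →
      fromℕ n ≃ fromℕ 2 * geometricSum q (suc ℓ) →
      fromℕ m ≤ fromℚ ½ * (q + fromℕ 1) * fromℕ n
    attained-bound {ℓ} {n} (G , bip , free , refl) q (η , 0<η , M , q-pos) n≃ ε 0<ε = finish (n≃ δ 0<δ)
      where
      δ : ℚ.ℚ
      δ = ε ℚ.* recip (ℚ.1ℚ ℚ.+ ι n)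
      0<1+n : ℚ.0ℚ ℚ.< ℚ.1ℚ ℚ.+ ι n
      0<1+n = ℚₚ.+-mono-<-≤ 0<1 (0≤ι n)
      δ*[1+n] : δ ℚ.* (ℚ.1ℚ ℚ.+ ι n) ≡ ε
      δ*[1+n] = trans (ℚₚ.*-assoc ε _ _) (trans (cong (ε ℚ.*_)
        (trans (ℚₚ.*-comm (recip (ℚ.1ℚ ℚ.+ ι n)) (ℚ.1ℚ ℚ.+ ι n)) (*-recipʳ-pos 0<1+n))) (ℚₚ.*-identityʳ ε))
      0<δ : ℚ.0ℚ ℚ.< δ
      0<δ = ℚₚ.*-cancelʳ-<-nonNeg (ℚ.1ℚ ℚ.+ ι n) {{ℚ.nonNegative (ℚₚ.<⇒≤ 0<1+n)}}
        (subst₂ ℚ._<_ (sym (ℚₚ.*-zeroˡ (ℚ.1ℚ ℚ.+ ι n))) (sym δ*[1+n]) 0<ε)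
      finish : _ → _
      finish (N , close) = M ℕ.⊔ N , λ i M⊔N≤i →
        let x = seq q i
            0≤x : ℚ.0ℚ ℚ.≤ x
            0≤x = ℚₚ.≤-trans (ℚₚ.<⇒≤ 0<η) (ℚₚ.≤-trans (ℚₚ.≤-reflexive (sym (ℚₚ.+-identityˡ η)))
              (q-pos i (ℕₚ.m⊔n≤o⇒m≤o M N M⊔N≤i)))
            n≤ : ι n ℚ.≤ 2ℚ ℚ.* geometric x (suc ℓ) ℚ.+ δ
            n≤ = subst₂ (λ a b → a ℚ.≤ 2ℚ ℚ.* b ℚ.+ δ) (ι≡/1 n) (seq-geometricSum q (suc ℓ) i)
              (∣p-q∣≤d⇒p≤q+d (close i (ℕₚ.m⊔n≤o⇒n≤o M N M⊔N≤i)))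
        in subst₂ ℚ._≤_ (sym (ι≡/1 ∣E G ∣))
             (cong₂ (λ a b → ½ ℚ.* (x ℚ.+ ℚ.1ℚ) ℚ.* a ℚ.+ b) (sym (ι≡/1 n)) δ*[1+n])
             (edge-bound 0≤x (ℚₚ.<⇒≤ 0<δ) n≤ G bip free)

open import Data.Nat using (suc; s≤s)
open import Data.Product using (proj₁)

proposition1p4 : (ℓ : ℕ) → ℓ ≥ 2 → (n : ℕ) → (q : ℝ) → fromℕ 0 < q →
    fromℕ n ≃ fromℕ 2 * geometricSum q ℓ →
    fromℕ (z n (𝓒 ℓ)) ≤ fromℚ ½ * (q + fromℕ 1) * fromℕ n
proposition1p4 (suc ℓ) (s≤s _) n = Limit.attained-bound (proj₁ (z-isMaximum n (𝓒 (suc ℓ))))
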